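{- There is an absolute constant $0<c<1$ such that for every integer $q\ge 3$ the following holds. For each $n$, generate a random spanoid $\mathcal S$ on $[n]$ as follows: independently for each $i\in[n]$, choose uniformly at random a collection $M_i$ of $\lfloor n/(2q)\rfloor$ pairwise disjoint $q$-element subsets of $[n]$, and let $\mathcal S=\{(T,i): i\in[n],\,T\in M_i\}$. Then the probability that $\mathrm{rank}(\mathcal S)> c\,n^{\frac{q-2}{q-1}}/\log_2 n$ tends to $1$ as $n\to\infty$.
   Context: A spanoid $\mathcal S$ on $[n]=\{1,\dots,n\}$ is a family of pairs $(S,i)$ with $S\subseteq[n]$, $i\in[n]$ (rules). For $T\subseteq[n]$ and $i\in[n]$ write $T\models i$ if there is a sequence $T=T_0,T_1,\dots,T_r$ ($r\ge 0$) with $i\in T_r$ such that for each $j\in[r]$, $T_j=T_{j-1}\cup\{i_j\}$ for some $i_j\in[n]$ for which there is $S\subseteq T_{j-1}$ with $(S,i_j)\in\mathcal S$. $\mathrm{span}(T)=\{i: T\models i\}$, and $\mathrm{rank}(\mathcal S)$ is the minimum size of $T\subseteq[n]$ with $\mathrm{span}(T)=[n]$. -}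

module Defs where

open import Data.Nat using (ℕ; zero; suc; _+_; _*_; _^_; _≤_; _<_; _/_)
open import Data.Bool using (Bool; true; false; T; _∧_; not)
open import Data.Vec using (Vec; []; _∷_; lookup; zipWith)
open import Data.Fin using (Fin)
open import Data.Fin.Subset using (Subset; _∈_; _⊆_; _∪_; ⁅_⁆; ∣_∣)
open import Data.List using (List; []; _∷_; _++_; map; concatMap; length; filter)
open import Data.Bool.ListAction using (and)
open import Data.Product using (Σ; ∃; _×_; _,_)
open import Data.Empty using (⊥)
open import Relation.Nullary using (¬_)
open import Relation.Binary.PropositionalEquality using (_≡_)
open import Data.Nat using (_≡ᵇ_)
open import Data.List.Relation.Unary.All using (All)

private variable n : ℕ

Spanoid : ℕ → Set₁
Spanoid n = Subset n → Fin n → Set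

-- 𝒮 ⊢ T ⊨ i : there is a sequence T = T₀ ⊆ T₁ ⊆ … ⊆ T_r with i ∈ T_r, where
-- T_j = T_{j-1} ∪ {i_j} and some rule (S , i_j) ∈ 𝒮 has S ⊆ T_{j-1}.
data _⊢_⊨_ {n : ℕ} (𝒮 : Spanoid n) : Subset n → Fin n → Set where
  here : ∀ {T i} → i ∈ T → 𝒮 ⊢ T ⊨ i
  step : ∀ {T i} (j : Fin n) (S : Subset n) → S ⊆ T → 𝒮 S j →
         𝒮 ⊢ (T ∪ ⁅ j ⁆) ⊨ i → 𝒮 ⊢ T ⊨ i

Spans : Spanoid n → Subset n → Set
Spans 𝒮 T = ∀ i → 𝒮 ⊢ T ⊨ i

IsRank : Spanoid n → ℕ → Set
IsRank 𝒮 r = (∃ λ T → Spans 𝒮 T × ∣ T ∣ ≡ r) × (∀ T → Spans 𝒮 T → r ≤ ∣ T ∣)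

-- Sets of subsets of [n] (elements of P(P([n]))), as binary decision trees.

data PSet : ℕ → Set where
  leaf : Bool → PSet 0
  node : PSet n → PSet n → PSet (suc n)   -- left: first element absent, right: present

_∈ₚ_ : Subset n → PSet n → Set
[] ∈ₚ leaf b = T b
(false ∷ s) ∈ₚ node l r = s ∈ₚ l
(true ∷ s) ∈ₚ node l r = s ∈ₚ r

elems : PSet n → List (Subset n)
elems (leaf false) = []
elems (leaf true) = [] ∷ []
elems (node l r) = map (false ∷_) (elems l) ++ map (true ∷_) (elems r)

allPSets : ∀ n → List (PSet n)
allPSets zero = leaf false ∷ leaf true ∷ []
allPSets (suc n) = concatMap (λ l → map (node l) (allPSets n)) (allPSets n)

disjointᵇ : Subset n → Subset n → Bool
disjointᵇ [] [] = true
disjointᵇ (x ∷ xs) (y ∷ ys) = not (x ∧ y) ∧ disjointᵇ xs ys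

pairwiseDisjointᵇ : List (Subset n) → Bool
pairwiseDisjointᵇ [] = true
pairwiseDisjointᵇ (S ∷ Ss) = and (map (disjointᵇ S) Ss) ∧ pairwiseDisjointᵇ Ss

validᵇ : (k q : ℕ) → PSet n → Bool
validᵇ k q M = (length (elems M) ≡ᵇ k)
             ∧ and (map (λ S → ∣ S ∣ ≡ᵇ q) (elems M))
             ∧ pairwiseDisjointᵇ (elems M)

-- k = ⌊ n / (2q) ⌋   (q = 0 never used; set to 0)
numBlocks : ℕ → ℕ → ℕ
numBlocks n zero = 0
numBlocks n (suc q) = n / (2 * suc q)

numColls : (n q : ℕ) → ℕ
numColls n q = length (filter (λ M → T? (validᵇ (numBlocks n q) q M)) (allPSets n))
  where
  open import Relation.Nullary.Decidable using (Dec)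
  open import Data.Bool.Properties using (T?)

sampleSize : (n q : ℕ) → ℕ
sampleSize n q = numColls n q ^ n

spanoidOf : Vec (PSet n) n → Spanoid n
spanoidOf ω S i = S ∈ₚ lookup ω i

-- rank r > c n^{(q-2)/(q-1)} / log₂ n  with c = a/b, written exactly in ℕ:
-- equivalent to ∃ rational u/v < log₂ n (i.e. 2^u < n^v, v > 0) with
-- (a/b)^{q-1} n^{q-2} < (r u / v)^{q-1}.
BigRank : (a b q n r : ℕ) → Set
BigRank a b q n r = ∃ λ u → ∃ λ v → 0 < v × 2 ^ u < n ^ v ×
  a ^ (q Data.Nat.∸ 1) * n ^ (q Data.Nat.∸ 2) * v ^ (q Data.Nat.∸ 1)
    < (r * u) ^ (q Data.Nat.∸ 1) * b ^ (q Data.Nat.∸ 1)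

Good : (a b q n : ℕ) → Vec (PSet n) n → Set
Good a b q n ω =
  Data.Vec.Relation.Unary.All.All (λ M → T (validᵇ (numBlocks n q) q M)) ω
  × (∀ r → IsRank (spanoidOf ω) r → BigRank a b q n r)
  where import Data.Vec.Relation.Unary.All

{-# OPTIONS --safe #-}

-- Let d be maximal with (32 d)^(q-1) ≤ n^(q-2) and t maximal with n^t ≤ 2^d, so that
-- t + 1 > d / log₂ n. If a set T of size at most t spans, then the first d elements derived
-- from T form a set D such that every i ∈ D has a rule inside T ∪ D. For fixed T and D this
-- has probability at most ((2d)^q / n^(q-1))^d: since all q-sets are equally likely to be
-- blocks of M_i, double counting gives P(M_i has a block inside W) ≤ |W|^q / n^(q-1).
-- The union bound over at most (n+1)^t ≤ 4^d sets T and (n C d) ≤ (4n/d)^d sets D then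
-- leaves a failure probability of at most 2^-d.
module Submission where

open import Defs
open import Data.Bool using (Bool; true; false; T; _∧_; not; if_then_else_)
open import Data.Bool.ListAction using (and; any)
open import Data.Bool.Properties using (T?; T-∧; ∧-assoc; ∧-comm; ∧-zeroʳ)
open import Data.Empty using (⊥-elim)
open import Data.Fin using (zero; suc)
open import Data.Fin.Subset using (Subset; _∈_; _∉_; _⊆_; _∪_; ⁅_⁆; ∣_∣; ⊤; ⊥)
open import Data.Fin.Subset.Properties
  using (∣p∣≤n; ∣⊤∣≡n; ∣⊥∣≡0; ∉⊥; ⊆⊤; drop-∷-⊆; drop-there;
         p⊆p∪q; q⊆p∪q; x∈p∪q⁻; x∈⁅y⁆⇒x≡y; ∪-identityʳ; _∈?_)
open import Data.List using (List; []; _∷_; _++_; map; concatMap; cartesianProductWith; filter; length)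
open import Data.List.Properties using (map-++; map-∘; map-cong; length-map; length-++; map-id; ++-assoc)
open import Data.List.Membership.Propositional using (lose) renaming (_∈_ to _∈ˡ_)
open import Data.List.Membership.Propositional.Properties using (∈-map⁺; ∈-++⁺ˡ; ∈-++⁺ʳ)
open import Data.List.Relation.Binary.Permutation.Propositional
  using (_↭_; refl; prep; swap; trans; ↭-trans; ↭-reflexive)
open import Data.List.Relation.Binary.Permutation.Propositional.Properties
  using (map⁺; ++⁺; ++⁺ˡ; ↭-length; shifts)
open import Data.List.Relation.Unary.All using (All; []; _∷_)
import Data.List.Relation.Unary.All as All
open import Data.List.Relation.Unary.All.Properties using (all⁺; all-filter)
import Data.List.Relation.Unary.All.Properties as Allₚ
open import Data.List.Relation.Unary.Any using (here; there)
open import Data.List.Relation.Unary.Any.Properties using (any⁺)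
open import Data.List.Relation.Unary.AllPairs using ([]; _∷_)
open import Data.List.Relation.Unary.Unique.Propositional using (Unique)
import Data.List.Relation.Unary.Unique.Propositional.Properties as Uniqueₚ
open import Data.Nat
open import Data.Nat.Combinatorics using (_C_; nCk+nC[k+1]≡[n+1]C[k+1])
open import Data.Nat.DivMod using (m/n≤m)
open import Data.Nat.ListAction using (sum)
open import Data.Nat.ListAction.Properties using (sum-++)
open import Data.Nat.Properties
open import Data.Nat.Tactic.RingSolver using (solve-∀)
open import Data.Product using (∃; _×_; _,_; proj₁; proj₂)
open import Data.Sum using (inj₁; inj₂)
open import Data.Vec using (Vec; []; _∷_; lookup)
import Data.Vec
import Data.Vec.Relation.Unary.All as Vecₐ
import Data.Vec.Relation.Unary.All.Properties as Vecₐₚ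
open import Function using (_∘_; id)
open import Function.Bundles using (Equivalence)
open import Level using (Level)
open import Relation.Binary.PropositionalEquality
  using (_≡_; refl; sym; cong; cong₂; subst; module ≡-Reasoning) renaming (trans to ≡-trans)
open import Relation.Nullary using (¬_; Dec; yes; no)

-- The exponent (q-2)/(q-1) hinges on forgetting the order of derivation. Each element of D is only
-- required to have a rule inside the one set T ∪ D, so D is chosen as an unordered set, and the
-- gain of 1/d per element in (4n/d)^d is decisive: with n^d ordered choices the same computation
-- would stop at d of order n^((q-2)/q). The blocks of one M_i are dependent, and the number of
-- admissible collections has no convenient formula. Both difficulties are bypassed: only the total
-- number of blocks inside W is bounded, and relabelling the ground set shows that all q-sets have
-- one common frequency, which is then eliminated between two counts. Probabilities appear as counts
-- with cleared denominators. Per element of D the factors are 4 for T, 4n/d for D, (2d)^q/n^(q-1)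
-- for the event and 2 for the final margin, together 64 (2d)^(q-1)/n^(q-2). Since 64 ≤ 16^(q-1),
-- the condition (32d)^(q-1) ≤ n^(q-2) suffices. The constant c = 1/64 then comes from d + 1 ≤ 2d.

private
  variable
    ℓ : Level
    A B : Set ℓ
    n : ℕ

-- Arithmetic

*-^-distrib : ∀ m n o → (m * n) ^ o ≡ m ^ o * n ^ o
*-^-distrib m n zero    = refl
*-^-distrib m n (suc o) =
  ≡-trans (cong (m * n *_) (*-^-distrib m n o)) ([m*n]*[o*p]≡[m*o]*[n*p] m n (m ^ o) (n ^ o))

[1+k]*[1+n]C[1+k]≡[1+n]*nCk : ∀ n k → suc k * (suc n C suc k) ≡ suc n * (n C k)
[1+k]*[1+n]C[1+k]≡[1+n]*nCk zero    zero    = refl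
[1+k]*[1+n]C[1+k]≡[1+n]*nCk zero    (suc k) = *-zeroʳ k
[1+k]*[1+n]C[1+k]≡[1+n]*nCk (suc n) zero    = begin
  1 * (suc (suc n) C 1)             ≡⟨ cong (1 *_) (nCk+nC[k+1]≡[n+1]C[k+1] (suc n) 0) ⟨
  1 * (1 + (suc n C 1))             ≡⟨ *-identityˡ _ ⟩
  1 + (suc n C 1)                   ≡⟨ cong (1 +_) (*-identityˡ _) ⟨
  1 + 1 * (suc n C 1)               ≡⟨ cong (1 +_) ([1+k]*[1+n]C[1+k]≡[1+n]*nCk n 0) ⟩
  suc (suc n) * 1                   ∎
  where open ≡-Reasoning
[1+k]*[1+n]C[1+k]≡[1+n]*nCk (suc n) (suc k) = begin
  suc (suc k) * (suc (suc n) C suc (suc k))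
    ≡⟨ cong (suc (suc k) *_) (nCk+nC[k+1]≡[n+1]C[k+1] (suc n) (suc k)) ⟨
  suc (suc k) * (x + y)             ≡⟨ expand k x y ⟩
  x + (suc k * x + suc (suc k) * y)
    ≡⟨ cong (x +_) (cong₂ _+_ ([1+k]*[1+n]C[1+k]≡[1+n]*nCk n k) ([1+k]*[1+n]C[1+k]≡[1+n]*nCk n (suc k))) ⟩
  x + (suc n * (n C k) + suc n * (n C suc k))
    ≡⟨ cong (x +_) (*-distribˡ-+ (suc n) (n C k) (n C suc k)) ⟨
  x + suc n * ((n C k) + (n C suc k))
    ≡⟨ cong (λ z → x + suc n * z) (nCk+nC[k+1]≡[n+1]C[k+1] n k) ⟩
  suc (suc n) * x                   ∎
  where
  open ≡-Reasoning
  x = suc n C suc k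
  y = suc n C suc (suc k)
  expand : ∀ k x y → suc (suc k) * (x + y) ≡ x + (suc k * x + suc (suc k) * y)
  expand = solve-∀

-- (w ∸ i) / (n ∸ i) ≤ (w + j) / (n + j); the offset j makes the induction on q go through.
C-ratio-≤ : ∀ q j {w n} → w ≤ n → (w C q) * (n + j) ^ q ≤ (w + j) ^ q * (n C q)
C-ratio-≤ zero    j _ = ≤-refl
C-ratio-≤ (suc q) j {zero}  {n}     _         = z≤n
C-ratio-≤ (suc q) j {suc w} {suc n} (s≤s w≤n) = *-cancelˡ-≤ (suc q) (begin
  suc q * ((suc w C suc q) * (N * N ^ q))          ≡⟨ *-assoc (suc q) (suc w C suc q) _ ⟨
  suc q * (suc w C suc q) * (N * N ^ q)            ≡⟨ cong (_* (N * N ^ q)) ([1+k]*[1+n]C[1+k]≡[1+n]*nCk w q) ⟩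
  suc w * (w C q) * (N * N ^ q)                    ≡⟨ [m*n]*[o*p]≡[m*o]*[n*p] (suc w) (w C q) N (N ^ q) ⟩
  suc w * N * ((w C q) * N ^ q)                    ≤⟨ *-mono-≤ slope ih ⟩
  W * suc n * (W ^ q * (n C q))                    ≡⟨ [m*n]*[o*p]≡[m*o]*[n*p] W (suc n) (W ^ q) (n C q) ⟩
  W * W ^ q * (suc n * (n C q))                    ≡⟨ cong (W * W ^ q *_) ([1+k]*[1+n]C[1+k]≡[1+n]*nCk n q) ⟨
  W * W ^ q * (suc q * (suc n C suc q))            ≡⟨ swapˡ (W * W ^ q) (suc q) (suc n C suc q) ⟩
  suc q * (W * W ^ q * (suc n C suc q))            ∎)
  where
  open ≤-Reasoning
  N = suc n + j
  W = suc w + j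
  swapˡ : ∀ a b c → a * (b * c) ≡ b * (a * c)
  swapˡ = solve-∀
  ih : (w C q) * N ^ q ≤ W ^ q * (n C q)
  ih = subst (λ z → (w C q) * z ^ q ≤ W ^ q * (n C q)) (+-suc n j)
        (subst (λ z → (w C q) * (n + suc j) ^ q ≤ z ^ q * (n C q)) (+-suc w j) (C-ratio-≤ q (suc j) w≤n))
  slope : suc w * N ≤ W * suc n
  slope = begin
    suc w * (suc n + j)          ≡⟨ *-distribˡ-+ (suc w) (suc n) j ⟩
    suc w * suc n + suc w * j    ≤⟨ +-monoʳ-≤ (suc w * suc n) (*-monoˡ-≤ j (s≤s w≤n)) ⟩
    suc w * suc n + suc n * j    ≡⟨ cong (suc w * suc n +_) (*-comm (suc n) j) ⟩
    suc w * suc n + j * suc n    ≡⟨ *-distribʳ-+ (suc n) (suc w) j ⟨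
    W * suc n                    ∎

nCk*k!≤n^k : ∀ n k → (n C k) * k ! ≤ n ^ k
nCk*k!≤n^k n       zero    = ≤-refl
nCk*k!≤n^k zero    (suc k) = z≤n
nCk*k!≤n^k (suc n) (suc k) = begin
  (suc n C suc k) * (suc k * k !)  ≡⟨ rotate (suc n C suc k) (suc k) (k !) ⟩
  suc k * (suc n C suc k) * k !    ≡⟨ cong (_* k !) ([1+k]*[1+n]C[1+k]≡[1+n]*nCk n k) ⟩
  suc n * (n C k) * k !            ≡⟨ *-assoc (suc n) (n C k) (k !) ⟩
  suc n * ((n C k) * k !)          ≤⟨ *-monoʳ-≤ (suc n) (nCk*k!≤n^k n k) ⟩
  suc n * n ^ k                    ≤⟨ *-monoʳ-≤ (suc n) (^-monoˡ-≤ k (n≤1+n n)) ⟩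
  suc n * suc n ^ k                ∎
  where
  open ≤-Reasoning
  rotate : ∀ a b c → a * (b * c) ≡ b * a * c
  rotate = solve-∀

-- The right-hand side is the product (m+1)...(m+k), all of whose k factors exceed m.
m^k≤[m+k]Ck*k! : ∀ m k → m ^ k ≤ ((m + k) C k) * k !
m^k≤[m+k]Ck*k! m zero    = ≤-refl
m^k≤[m+k]Ck*k! m (suc k) rewrite +-suc m k = begin
  m * m ^ k                                 ≤⟨ *-mono-≤ (m≤n⇒m≤1+n (m≤m+n m k)) (m^k≤[m+k]Ck*k! m k) ⟩
  suc (m + k) * (((m + k) C k) * k !)       ≡⟨ *-assoc (suc (m + k)) ((m + k) C k) (k !) ⟨
  suc (m + k) * ((m + k) C k) * k !         ≡⟨ cong (_* k !) ([1+k]*[1+n]C[1+k]≡[1+n]*nCk (m + k) k) ⟨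
  suc k * (suc (m + k) C suc k) * k !       ≡⟨ rotate (suc k) (suc (m + k) C suc k) (k !) ⟩
  (suc (m + k) C suc k) * (suc k * k !)     ∎
  where
  open ≤-Reasoning
  rotate : ∀ a b c → a * b * c ≡ b * (a * c)
  rotate = solve-∀

nCk≤2^n : ∀ n k → n C k ≤ 2 ^ n
nCk≤2^n n       zero    = m^n>0 2 n
nCk≤2^n zero    (suc k) = z≤n
nCk≤2^n (suc n) (suc k) = begin
  suc n C suc k            ≡⟨ nCk+nC[k+1]≡[n+1]C[k+1] n k ⟨
  (n C k) + (n C suc k)    ≤⟨ +-mono-≤ (nCk≤2^n n k) (≤-trans (nCk≤2^n n (suc k)) (m≤m+n (2 ^ n) 0)) ⟩
  2 ^ suc n                ∎
  where open ≤-Reasoning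

-- Taking m = k in `m^k≤[m+k]Ck*k!` gives k^k ≤ C(2k,k) k! ≤ 4^k k!, an elementary substitute for
-- Stirling's k! ≥ (k/e)^k.
nCk*k^k≤[4n]^k : ∀ n k → (n C k) * k ^ k ≤ (4 * n) ^ k
nCk*k^k≤[4n]^k n k = begin
  (n C k) * k ^ k                     ≤⟨ *-monoʳ-≤ (n C k) (m^k≤[m+k]Ck*k! k k) ⟩
  (n C k) * (((k + k) C k) * k !)     ≤⟨ *-monoʳ-≤ (n C k) (*-monoˡ-≤ (k !) (nCk≤2^n (k + k) k)) ⟩
  (n C k) * (2 ^ (k + k) * k !)       ≡⟨ swapˡ (n C k) (2 ^ (k + k)) (k !) ⟩
  2 ^ (k + k) * ((n C k) * k !)       ≤⟨ *-monoʳ-≤ (2 ^ (k + k)) (nCk*k!≤n^k n k) ⟩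
  2 ^ (k + k) * n ^ k                 ≡⟨ cong (_* n ^ k) (^-distribˡ-+-* 2 k k) ⟩
  2 ^ k * 2 ^ k * n ^ k               ≡⟨ cong (_* n ^ k) (*-^-distrib 2 2 k) ⟨
  4 ^ k * n ^ k                       ≡⟨ *-^-distrib 4 n k ⟨
  (4 * n) ^ k                         ∎
  where
  open ≤-Reasoning
  swapˡ : ∀ a b c → a * (b * c) ≡ b * (a * c)
  swapˡ = solve-∀

-- The search moves upward from `l` and stops just before the first failure, which occurs by `l + k`
-- at the latest. Both scales of the proof are chosen this way, and their maximality means exactly
-- that the next value fails.
last-true : ∀ (P : ℕ → Set) → (∀ n → Dec (P n)) → ∀ l k → P l → ¬ P (l + k) →
            ∃ λ d → l ≤ d × P d × ¬ P (suc d)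
last-true P P? l zero    Pl ¬Pu = ⊥-elim (¬Pu (subst P (sym (+-identityʳ l)) Pl))
last-true P P? l (suc k) Pl ¬Pu with P? (suc l)
... | no ¬P1+l = l , ≤-refl , Pl , ¬P1+l
... | yes P1+l with last-true P P? (suc l) k P1+l (¬Pu ∘ subst P (sym (+-suc l k)))
...   | d , l<d , Pd , ¬P1+d = d , <⇒≤ l<d , Pd , ¬P1+d

-- Finite sums

∑ : List A → (A → ℕ) → ℕ
∑ xs f = sum (map f xs)

⟦_⟧ : Bool → ℕ
⟦ b ⟧ = if b then 1 else 0

∑-mono : ∀ (xs : List A) {f g : A → ℕ} → (∀ x → f x ≤ g x) → ∑ xs f ≤ ∑ xs g
∑-mono []       f≤g = z≤n
∑-mono (x ∷ xs) f≤g = +-mono-≤ (f≤g x) (∑-mono xs f≤g)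

∑-cong : ∀ (xs : List A) {f g : A → ℕ} → (∀ x → f x ≡ g x) → ∑ xs f ≡ ∑ xs g
∑-cong xs f≡g = cong sum (map-cong f≡g xs)

∑-++ : ∀ (xs ys : List A) (f : A → ℕ) → ∑ (xs ++ ys) f ≡ ∑ xs f + ∑ ys f
∑-++ xs ys f = ≡-trans (cong sum (map-++ f xs ys)) (sum-++ (map f xs) (map f ys))

∑-map : ∀ (g : A → B) (xs : List A) (f : B → ℕ) → ∑ (map g xs) f ≡ ∑ xs (f ∘ g)
∑-map g xs f = cong sum (sym (map-∘ xs))

∑-*ʳ : ∀ (xs : List A) (f : A → ℕ) c → ∑ xs f * c ≡ ∑ xs (λ x → f x * c)
∑-*ʳ []       f c = refl
∑-*ʳ (x ∷ xs) f c = ≡-trans (*-distribʳ-+ c (f x) (∑ xs f)) (cong (f x * c +_) (∑-*ʳ xs f c))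

∑-+ : ∀ (xs : List A) (f g : A → ℕ) → ∑ xs (λ x → f x + g x) ≡ ∑ xs f + ∑ xs g
∑-+ []       f g = refl
∑-+ (x ∷ xs) f g = ≡-trans (cong (f x + g x +_) (∑-+ xs f g)) (interchange (f x) (g x) (∑ xs f) (∑ xs g))
  where
  interchange : ∀ a b c d → (a + b) + (c + d) ≡ (a + c) + (b + d)
  interchange = solve-∀

∑-zero : ∀ (xs : List A) → ∑ xs (λ _ → 0) ≡ 0
∑-zero []       = refl
∑-zero (x ∷ xs) = ∑-zero xs

∑-swap : ∀ (xs : List A) (ys : List B) (f : A → B → ℕ) →
         ∑ xs (λ x → ∑ ys (f x)) ≡ ∑ ys (λ y → ∑ xs (λ x → f x y))
∑-swap []       ys f = sym (∑-zero ys)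
∑-swap (x ∷ xs) ys f =
  ≡-trans (cong (∑ ys (f x) +_) (∑-swap xs ys f)) (sym (∑-+ ys (f x) (λ y → ∑ xs (λ x → f x y))))

∑-const : ∀ (xs : List A) {f : A → ℕ} {c} → All (λ x → f x ≡ c) xs → ∑ xs f ≡ length xs * c
∑-const []       []       = refl
∑-const (x ∷ xs) (p ∷ ps) = cong₂ _+_ p (∑-const xs ps)

∑-≤-const : ∀ (xs : List A) {f : A → ℕ} {c} → All (λ x → f x ≤ c) xs → ∑ xs f ≤ length xs * c
∑-≤-const []       []       = z≤n
∑-≤-const (x ∷ xs) (p ∷ ps) = +-mono-≤ p (∑-≤-const xs ps)

∑-cartesianProductWith : ∀ {C : Set ℓ} (h : A → B → C) xs ys (f : C → ℕ) →
  ∑ (cartesianProductWith h xs ys) f ≡ ∑ xs (λ x → ∑ ys (λ y → f (h x y)))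
∑-cartesianProductWith h []       ys f = refl
∑-cartesianProductWith h (x ∷ xs) ys f =
  ≡-trans (∑-++ (map (h x) ys) _ f) (cong₂ _+_ (∑-map (h x) ys f) (∑-cartesianProductWith h xs ys f))

-- The union bound at a single sample point; summing over the samples turns it into a bound on
-- counts.
∑-⟦⟧-any : ∀ (p : A → Bool) xs → ⟦ any p xs ⟧ ≤ ∑ xs (⟦_⟧ ∘ p)
∑-⟦⟧-any p []       = z≤n
∑-⟦⟧-any p (x ∷ xs) with p x
... | true  = s≤s z≤n
... | false = ∑-⟦⟧-any p xs

∑-filter : ∀ (p : A → Bool) xs (f : A → ℕ) → ∑ (filter (T? ∘ p) xs) f ≡ ∑ xs (λ x → ⟦ p x ⟧ * f x)
∑-filter p []       f = refl
∑-filter p (x ∷ xs) f with p x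
... | true  = cong₂ _+_ (sym (+-identityʳ (f x))) (∑-filter p xs f)
... | false = ∑-filter p xs f

length-filter-not : ∀ (p : A → Bool) xs →
  length (filter (T? ∘ not ∘ p) xs) + ∑ xs (⟦_⟧ ∘ p) ≡ length xs
length-filter-not p []       = refl
length-filter-not p (x ∷ xs) with p x
... | true  = ≡-trans (+-suc _ _) (cong suc (length-filter-not p xs))
... | false = cong suc (length-filter-not p xs)

-- Enumerations of subsets

kSubsets : Subset n → ℕ → List (Subset n)
kSubsets []          zero    = [] ∷ []
kSubsets []          (suc k) = []
kSubsets (false ∷ W) k       = map (false ∷_) (kSubsets W k)
kSubsets (true ∷ W)  zero    = map (false ∷_) (kSubsets W zero)
kSubsets (true ∷ W)  (suc k) = map (true ∷_) (kSubsets W k) ++ map (false ∷_) (kSubsets W (suc k))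

length-kSubsets : ∀ (W : Subset n) k → length (kSubsets W k) ≡ ∣ W ∣ C k
length-kSubsets []          zero    = refl
length-kSubsets []          (suc k) = refl
length-kSubsets (false ∷ W) k       = ≡-trans (length-map _ (kSubsets W k)) (length-kSubsets W k)
length-kSubsets (true ∷ W)  zero    = ≡-trans (length-map _ (kSubsets W zero)) (length-kSubsets W zero)
length-kSubsets (true ∷ W)  (suc k) = begin
  length (map (true ∷_) (kSubsets W k) ++ map (false ∷_) (kSubsets W (suc k)))
    ≡⟨ length-++ (map (true ∷_) (kSubsets W k)) ⟩
  length (map (true ∷_) (kSubsets W k)) + length (map (false ∷_) (kSubsets W (suc k)))
    ≡⟨ cong₂ _+_ (≡-trans (length-map _ (kSubsets W k)) (length-kSubsets W k))
                 (≡-trans (length-map _ (kSubsets W (suc k))) (length-kSubsets W (suc k))) ⟩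
  (∣ W ∣ C k) + (∣ W ∣ C suc k)
    ≡⟨ nCk+nC[k+1]≡[n+1]C[k+1] ∣ W ∣ k ⟩
  suc ∣ W ∣ C suc k ∎
  where open ≡-Reasoning

kSubsets-size : ∀ (W : Subset n) k → All (λ S → ∣ S ∣ ≡ k) (kSubsets W k)
kSubsets-size []          zero    = refl ∷ []
kSubsets-size []          (suc k) = []
kSubsets-size (false ∷ W) k       = Allₚ.map⁺ (kSubsets-size W k)
kSubsets-size (true ∷ W)  zero    = Allₚ.map⁺ (kSubsets-size W zero)
kSubsets-size (true ∷ W)  (suc k) =
  Allₚ.++⁺ (Allₚ.map⁺ (All.map (cong suc) (kSubsets-size W k))) (Allₚ.map⁺ (kSubsets-size W (suc k)))

kSubsets-complete : ∀ (S W : Subset n) → S ⊆ W → S ∈ˡ kSubsets W ∣ S ∣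
kSubsets-complete []          []          S⊆W = here refl
kSubsets-complete (false ∷ S) (false ∷ W) S⊆W = ∈-map⁺ (false ∷_) (kSubsets-complete S W (drop-∷-⊆ S⊆W))
kSubsets-complete (true ∷ S)  (false ∷ W) S⊆W with () ← S⊆W Data.Vec.here
kSubsets-complete (false ∷ S) (true ∷ W)  S⊆W with ∣ S ∣ | kSubsets-complete S W (drop-∷-⊆ S⊆W)
... | zero  | S∈ = ∈-map⁺ (false ∷_) S∈
... | suc k | S∈ = ∈-++⁺ʳ (map (true ∷_) (kSubsets W k)) (∈-map⁺ (false ∷_) S∈)
kSubsets-complete (true ∷ S)  (true ∷ W)  S⊆W =
  ∈-++⁺ˡ (∈-map⁺ (true ∷_) (kSubsets-complete S W (drop-∷-⊆ S⊆W)))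

subsetsUpTo : ∀ n → ℕ → List (Subset n)
subsetsUpTo zero    t       = [] ∷ []
subsetsUpTo (suc n) zero    = map (false ∷_) (subsetsUpTo n zero)
subsetsUpTo (suc n) (suc t) = map (true ∷_) (subsetsUpTo n t) ++ map (false ∷_) (subsetsUpTo n (suc t))

-- The bound is the number of words of length t over the n elements and a blank. In the recursive
-- step the two parts add up to (n+1)^t + (n+1)^(t+1) = (n+2)(n+1)^t.
length-subsetsUpTo : ∀ n t → length (subsetsUpTo n t) ≤ suc n ^ t
length-subsetsUpTo zero    t       = m^n>0 1 t
length-subsetsUpTo (suc n) zero    = ≤-trans (≤-reflexive (length-map _ (subsetsUpTo n zero))) (length-subsetsUpTo n zero)
length-subsetsUpTo (suc n) (suc t) = begin
  length (map (true ∷_) (subsetsUpTo n t) ++ map (false ∷_) (subsetsUpTo n (suc t)))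
    ≡⟨ length-++ (map (true ∷_) (subsetsUpTo n t)) ⟩
  length (map (true ∷_) (subsetsUpTo n t)) + length (map (false ∷_) (subsetsUpTo n (suc t)))
    ≡⟨ cong₂ _+_ (length-map _ (subsetsUpTo n t)) (length-map _ (subsetsUpTo n (suc t))) ⟩
  length (subsetsUpTo n t) + length (subsetsUpTo n (suc t))
    ≤⟨ +-mono-≤ (length-subsetsUpTo n t) (length-subsetsUpTo n (suc t)) ⟩
  suc (suc n) * suc n ^ t
    ≤⟨ *-monoʳ-≤ (suc (suc n)) (^-monoˡ-≤ t (n≤1+n (suc n))) ⟩
  suc (suc n) ^ suc t ∎
  where open ≤-Reasoning

subsetsUpTo-size : ∀ n t → All (λ S → ∣ S ∣ ≤ t) (subsetsUpTo n t)
subsetsUpTo-size zero    t       = z≤n ∷ []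
subsetsUpTo-size (suc n) zero    = Allₚ.map⁺ (subsetsUpTo-size n zero)
subsetsUpTo-size (suc n) (suc t) =
  Allₚ.++⁺ (Allₚ.map⁺ (All.map s≤s (subsetsUpTo-size n t))) (Allₚ.map⁺ (subsetsUpTo-size n (suc t)))

subsetsUpTo-complete : ∀ t (S : Subset n) → ∣ S ∣ ≤ t → S ∈ˡ subsetsUpTo n t
subsetsUpTo-complete t       []          _       = here refl
subsetsUpTo-complete zero    (false ∷ S) S≤      = ∈-map⁺ (false ∷_) (subsetsUpTo-complete zero S S≤)
subsetsUpTo-complete (suc t) (true ∷ S)  (s≤s S≤) = ∈-++⁺ˡ (∈-map⁺ (true ∷_) (subsetsUpTo-complete t S S≤))
subsetsUpTo-complete {suc n} (suc t) (false ∷ S) S≤ =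
  ∈-++⁺ʳ (map (true ∷_) (subsetsUpTo n t)) (∈-map⁺ (false ∷_) (subsetsUpTo-complete (suc t) S S≤))

-- Collections of subsets

concatMap-map : ∀ {C : Set ℓ} (h : A → B → C) xs ys →
                concatMap (λ x → map (h x) ys) xs ≡ cartesianProductWith h xs ys
concatMap-map h []       ys = refl
concatMap-map h (x ∷ xs) ys = cong (map (h x) ys ++_) (concatMap-map h xs ys)

allPSets-suc : ∀ n → allPSets (suc n) ≡ cartesianProductWith node (allPSets n) (allPSets n)
allPSets-suc n = concatMap-map node (allPSets n) (allPSets n)

∑-allPSets : ∀ n (f : PSet (suc n) → ℕ) →
  ∑ (allPSets (suc n)) f ≡ ∑ (allPSets n) (λ l → ∑ (allPSets n) (λ r → f (node l r)))
∑-allPSets n f = ≡-trans (cong (λ xs → ∑ xs f) (allPSets-suc n))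
                         (∑-cartesianProductWith node (allPSets n) (allPSets n) f)

allPSets-unique : ∀ n → Unique (allPSets n)
allPSets-unique zero    = ((λ ()) ∷ []) ∷ [] ∷ []
allPSets-unique (suc n) = subst Unique (sym (allPSets-suc n))
  (Uniqueₚ.cartesianProductWith⁺ node (λ { refl → refl , refl }) (allPSets-unique n) (allPSets-unique n))

memᵇ : Subset n → PSet n → Bool
memᵇ []          (leaf b)   = b
memᵇ (false ∷ S) (node l r) = memᵇ S l
memᵇ (true ∷ S)  (node l r) = memᵇ S r

∈ₚ⇒memᵇ : ∀ (S : Subset n) M → S ∈ₚ M → T (memᵇ S M)
∈ₚ⇒memᵇ []          (leaf b)   S∈M = S∈M
∈ₚ⇒memᵇ (false ∷ S) (node l r) S∈M = ∈ₚ⇒memᵇ S l S∈M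
∈ₚ⇒memᵇ (true ∷ S)  (node l r) S∈M = ∈ₚ⇒memᵇ S r S∈M

∈ₚ⇒∈-elems : ∀ (S : Subset n) M → S ∈ₚ M → S ∈ˡ elems M
∈ₚ⇒∈-elems []          (leaf true) S∈M = here refl
∈ₚ⇒∈-elems (false ∷ S) (node l r)  S∈M = ∈-++⁺ˡ (∈-map⁺ (false ∷_) (∈ₚ⇒∈-elems S l S∈M))
∈ₚ⇒∈-elems (true ∷ S)  (node l r)  S∈M = ∈-++⁺ʳ (map (false ∷_) (elems l)) (∈-map⁺ (true ∷_) (∈ₚ⇒∈-elems S r S∈M))

length-elems-node : ∀ (l r : PSet n) → length (elems (node l r)) ≡ length (elems l) + length (elems r)
length-elems-node l r = ≡-trans (length-++ (map (false ∷_) (elems l)))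
                                (cong₂ _+_ (length-map _ (elems l)) (length-map _ (elems r)))

-- `kSubsets W k` repeats no set, so the members found occupy different entries of `elems M`; the
-- induction splits both enumerations by the first element. With `W = ⊤` this is one side of the
-- double count: each collection contributes at most its number of blocks.
∑-memᵇ≤length-elems : ∀ (W : Subset n) k M → ∑ (kSubsets W k) (λ S → ⟦ memᵇ S M ⟧) ≤ length (elems M)
∑-memᵇ≤length-elems []          zero    (leaf true)  = ≤-refl
∑-memᵇ≤length-elems []          zero    (leaf false) = ≤-refl
∑-memᵇ≤length-elems []          (suc k) M            = z≤n
∑-memᵇ≤length-elems (false ∷ W) k       (node l r)   = begin
  ∑ (map (false ∷_) (kSubsets W k)) _        ≡⟨ ∑-map (false ∷_) (kSubsets W k) _ ⟩
  ∑ (kSubsets W k) (λ S → ⟦ memᵇ S l ⟧)      ≤⟨ ∑-memᵇ≤length-elems W k l ⟩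
  length (elems l)                           ≤⟨ m≤m+n _ _ ⟩
  length (elems l) + length (elems r)        ≡⟨ length-elems-node l r ⟨
  length (elems (node l r))                  ∎
  where open ≤-Reasoning
∑-memᵇ≤length-elems (true ∷ W)  zero    (node l r)   = begin
  ∑ (map (false ∷_) (kSubsets W zero)) _     ≡⟨ ∑-map (false ∷_) (kSubsets W zero) _ ⟩
  ∑ (kSubsets W zero) (λ S → ⟦ memᵇ S l ⟧)   ≤⟨ ∑-memᵇ≤length-elems W zero l ⟩
  length (elems l)                           ≤⟨ m≤m+n _ _ ⟩
  length (elems l) + length (elems r)        ≡⟨ length-elems-node l r ⟨
  length (elems (node l r))                  ∎
  where open ≤-Reasoning
∑-memᵇ≤length-elems (true ∷ W)  (suc k) (node l r)   = begin
  ∑ (map (true ∷_) (kSubsets W k) ++ map (false ∷_) (kSubsets W (suc k))) (λ S → ⟦ memᵇ S (node l r) ⟧)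
    ≡⟨ ∑-++ (map (true ∷_) (kSubsets W k)) _ _ ⟩
  ∑ (map (true ∷_) (kSubsets W k)) _ + ∑ (map (false ∷_) (kSubsets W (suc k))) _
    ≡⟨ cong₂ _+_ (∑-map (true ∷_) (kSubsets W k) _) (∑-map (false ∷_) (kSubsets W (suc k)) _) ⟩
  ∑ (kSubsets W k) (λ S → ⟦ memᵇ S r ⟧) + ∑ (kSubsets W (suc k)) (λ S → ⟦ memᵇ S l ⟧)
    ≤⟨ +-mono-≤ (∑-memᵇ≤length-elems W k r) (∑-memᵇ≤length-elems W (suc k) l) ⟩
  length (elems r) + length (elems l)        ≡⟨ +-comm (length (elems r)) _ ⟩
  length (elems l) + length (elems r)        ≡⟨ length-elems-node l r ⟨
  length (elems (node l r))                  ∎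
  where open ≤-Reasoning

-- Symmetries

and-↭ : ∀ {xs ys} → xs ↭ ys → and xs ≡ and ys
and-↭ refl           = refl
and-↭ (prep x p)     = cong (x ∧_) (and-↭ p)
and-↭ (swap {xs} {ys} x y p) = begin
  x ∧ (y ∧ and xs)  ≡⟨ ∧-assoc x y (and xs) ⟨
  (x ∧ y) ∧ and xs  ≡⟨ cong₂ _∧_ (∧-comm x y) (and-↭ p) ⟩
  (y ∧ x) ∧ and ys  ≡⟨ ∧-assoc y x (and ys) ⟩
  y ∧ (x ∧ and ys)  ∎
  where open ≡-Reasoning
and-↭ (trans p p′)   = ≡-trans (and-↭ p) (and-↭ p′)

disjointᵇ-comm : ∀ (S S′ : Subset n) → disjointᵇ S S′ ≡ disjointᵇ S′ S
disjointᵇ-comm []      []        = refl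
disjointᵇ-comm (x ∷ S) (y ∷ S′) = cong₂ _∧_ (cong not (∧-comm x y)) (disjointᵇ-comm S S′)

-- `elems` lists sets in lexicographic order, which a relabelling of the ground set does not
-- preserve. The relabelled list is therefore known only up to permutation, and validity has to be
-- independent of the order. Exchanging two neighbours uses the symmetry of disjointness.
pairwiseDisjointᵇ-↭ : ∀ {xs ys : List (Subset n)} → xs ↭ ys → pairwiseDisjointᵇ xs ≡ pairwiseDisjointᵇ ys
pairwiseDisjointᵇ-↭ refl         = refl
pairwiseDisjointᵇ-↭ (prep x p)   = cong₂ _∧_ (and-↭ (map⁺ (disjointᵇ x) p)) (pairwiseDisjointᵇ-↭ p)
pairwiseDisjointᵇ-↭ (swap {xs} {ys} x y p) = begin
  (disjointᵇ x y ∧ X xs) ∧ (Y xs ∧ pairwiseDisjointᵇ xs)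
    ≡⟨ cong₂ (λ a b → (disjointᵇ x y ∧ a) ∧ b) (and-↭ (map⁺ (disjointᵇ x) p))
         (cong₂ _∧_ (and-↭ (map⁺ (disjointᵇ y) p)) (pairwiseDisjointᵇ-↭ p)) ⟩
  (disjointᵇ x y ∧ X ys) ∧ (Y ys ∧ pairwiseDisjointᵇ ys)
    ≡⟨ cong (λ a → (a ∧ X ys) ∧ (Y ys ∧ pairwiseDisjointᵇ ys)) (disjointᵇ-comm x y) ⟩
  (disjointᵇ y x ∧ X ys) ∧ (Y ys ∧ pairwiseDisjointᵇ ys)
    ≡⟨ ∧-interchange (disjointᵇ y x) (X ys) (Y ys) _ ⟩
  (disjointᵇ y x ∧ Y ys) ∧ (X ys ∧ pairwiseDisjointᵇ ys) ∎
  where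
  open ≡-Reasoning
  X = λ zs → and (map (disjointᵇ x) zs)
  Y = λ zs → and (map (disjointᵇ y) zs)
  ∧-interchange : ∀ a b c d → (a ∧ b) ∧ (c ∧ d) ≡ (a ∧ c) ∧ (b ∧ d)
  ∧-interchange false b     c d = refl
  ∧-interchange true  false c d = sym (∧-zeroʳ c)
  ∧-interchange true  true  c d = refl
pairwiseDisjointᵇ-↭ (trans p p′) = ≡-trans (pairwiseDisjointᵇ-↭ p) (pairwiseDisjointᵇ-↭ p′)

-- σ acts on subsets and τ is the induced action on collections; only these consequences of
-- σ being a permutation of the ground set are needed.
record Symmetry (n : ℕ) : Set where
  field
    σ         : Subset n → Subset n
    τ         : PSet n → PSet n
    σ-size    : ∀ S → ∣ σ S ∣ ≡ ∣ S ∣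
    σ-disj    : ∀ S S′ → disjointᵇ (σ S) (σ S′) ≡ disjointᵇ S S′
    σ-mem     : ∀ S M → memᵇ (σ S) (τ M) ≡ memᵇ S M
    τ-elems   : ∀ M → elems (τ M) ↭ map σ (elems M)
    τ-measure : ∀ f → ∑ (allPSets n) (f ∘ τ) ≡ ∑ (allPSets n) f

  and-size-σ : ∀ q xs → and (map (λ S → ∣ S ∣ ≡ᵇ q) (map σ xs)) ≡ and (map (λ S → ∣ S ∣ ≡ᵇ q) xs)
  and-size-σ q []       = refl
  and-size-σ q (S ∷ xs) = cong₂ _∧_ (cong (_≡ᵇ q) (σ-size S)) (and-size-σ q xs)

  pairwiseDisjointᵇ-σ : ∀ xs → pairwiseDisjointᵇ (map σ xs) ≡ pairwiseDisjointᵇ xs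
  pairwiseDisjointᵇ-σ []       = refl
  pairwiseDisjointᵇ-σ (S ∷ xs) = cong₂ _∧_ (disj xs) (pairwiseDisjointᵇ-σ xs)
    where
    disj : ∀ ys → and (map (disjointᵇ (σ S)) (map σ ys)) ≡ and (map (disjointᵇ S) ys)
    disj []       = refl
    disj (y ∷ ys) = cong₂ _∧_ (σ-disj S y) (disj ys)

  validᵇ-τ : ∀ k q M → validᵇ k q (τ M) ≡ validᵇ k q M
  validᵇ-τ k q M = cong₂ _∧_
    (cong (_≡ᵇ k) (≡-trans (↭-length (τ-elems M)) (length-map σ (elems M))))
    (cong₂ _∧_
      (≡-trans (and-↭ (map⁺ (λ S → ∣ S ∣ ≡ᵇ q) (τ-elems M))) (and-size-σ q (elems M)))
      (≡-trans (pairwiseDisjointᵇ-↭ (τ-elems M)) (pairwiseDisjointᵇ-σ (elems M))))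

open Symmetry

idₛ : Symmetry n
idₛ = record
  { σ = id ; τ = id
  ; σ-size = λ _ → refl ; σ-disj = λ _ _ → refl ; σ-mem = λ _ _ → refl
  ; τ-elems = λ M → ↭-reflexive (sym (map-id (elems M))) ; τ-measure = λ _ → refl
  }

_∘ₛ_ : Symmetry n → Symmetry n → Symmetry n
s ∘ₛ s′ = record
  { σ = σ s ∘ σ s′ ; τ = τ s ∘ τ s′
  ; σ-size = λ S → ≡-trans (σ-size s _) (σ-size s′ S)
  ; σ-disj = λ S S′ → ≡-trans (σ-disj s _ _) (σ-disj s′ S S′)
  ; σ-mem = λ S M → ≡-trans (σ-mem s _ _) (σ-mem s′ S M)
  ; τ-elems = λ M → ↭-trans (τ-elems s (τ s′ M))
      (↭-trans (map⁺ (σ s) (τ-elems s′ M)) (↭-reflexive (sym (map-∘ (elems M)))))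
  ; τ-measure = λ f → ≡-trans (τ-measure s′ (f ∘ τ s)) (τ-measure s f)
  }

liftₛ : Symmetry n → Symmetry (suc n)
liftₛ {n} s = record
  { σ = σ′ ; τ = τ′
  ; σ-size = λ { (false ∷ S) → σ-size s S ; (true ∷ S) → cong suc (σ-size s S) }
  ; σ-disj = λ { (x ∷ S) (y ∷ S′) → cong (not (x ∧ y) ∧_) (σ-disj s S S′) }
  ; σ-mem = λ { (false ∷ S) (node l r) → σ-mem s S l ; (true ∷ S) (node l r) → σ-mem s S r }
  ; τ-elems = λ { (node l r) → ↭-trans
      (++⁺ (branch false l) (branch true r))
      (↭-reflexive (sym (map-++ σ′ (map (false ∷_) (elems l)) _))) }
  ; τ-measure = measure
  }
  where
  σ′ : Subset (suc n) → Subset (suc n)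
  σ′ (x ∷ S) = x ∷ σ s S
  τ′ : PSet (suc n) → PSet (suc n)
  τ′ (node l r) = node (τ s l) (τ s r)
  branch : ∀ b M → map (b ∷_) (elems (τ s M)) ↭ map σ′ (map (b ∷_) (elems M))
  branch b M = ↭-trans (map⁺ (b ∷_) (τ-elems s M))
    (↭-reflexive (≡-trans (sym (map-∘ (elems M))) (map-∘ (elems M))))
  measure : ∀ f → ∑ (allPSets (suc n)) (f ∘ τ′) ≡ ∑ (allPSets (suc n)) f
  measure f = begin
    ∑ (allPSets (suc n)) (f ∘ τ′)
      ≡⟨ ∑-allPSets n (f ∘ τ′) ⟩
    ∑ (allPSets n) (λ l → ∑ (allPSets n) (λ r → f (node (τ s l) (τ s r))))
      ≡⟨ ∑-cong (allPSets n) (λ l → τ-measure s (λ r → f (node (τ s l) r))) ⟩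
    ∑ (allPSets n) (λ l → ∑ (allPSets n) (λ r → f (node (τ s l) r)))
      ≡⟨ τ-measure s (λ l → ∑ (allPSets n) (λ r → f (node l r))) ⟩
    ∑ (allPSets n) (λ l → ∑ (allPSets n) (λ r → f (node l r)))
      ≡⟨ ∑-allPSets n f ⟨
    ∑ (allPSets (suc n)) f ∎
    where open ≡-Reasoning

elems-node² : ∀ (a b c d : PSet n) → elems (node (node a b) (node c d)) ≡
  (map (λ S → false ∷ false ∷ S) (elems a) ++ map (λ S → false ∷ true ∷ S) (elems b)) ++
  (map (λ S → true ∷ false ∷ S) (elems c) ++ map (λ S → true ∷ true ∷ S) (elems d))
elems-node² {n} a b c d = cong₂ _++_ (half false a b) (half true c d)
  where
  half : ∀ x (a b : PSet n) → map (x ∷_) (map (false ∷_) (elems a) ++ map (true ∷_) (elems b)) ≡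
                   map (λ S → x ∷ false ∷ S) (elems a) ++ map (λ S → x ∷ true ∷ S) (elems b)
  half x a b = ≡-trans (map-++ (x ∷_) (map (false ∷_) (elems a)) _)
                       (cong₂ _++_ (sym (map-∘ (elems a))) (sym (map-∘ (elems b))))

-- Transposing the first two ground elements exchanges the inner subtrees `b` and `c`, so
-- `τ-measure` amounts to exchanging the two middle sums of a fourfold sum. With `liftₛ` and `_∘ₛ_`
-- this yields every adjacent transposition, hence every permutation.
swapₛ : Symmetry (suc (suc n))
swapₛ {n} = record
  { σ = σ′ ; τ = τ′
  ; σ-size = λ { (false ∷ false ∷ S) → refl ; (false ∷ true ∷ S) → refl
               ; (true ∷ false ∷ S) → refl ; (true ∷ true ∷ S) → refl }
  ; σ-disj = λ { (x ∷ y ∷ S) (x′ ∷ y′ ∷ S′) → ∧-swapˡ (not (y ∧ y′)) (not (x ∧ x′)) _ }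
  ; σ-mem = mem
  ; τ-elems = perm
  ; τ-measure = measure
  }
  where
  σ′ : Subset (suc (suc n)) → Subset (suc (suc n))
  σ′ (x ∷ y ∷ S) = y ∷ x ∷ S
  τ′ : PSet (suc (suc n)) → PSet (suc (suc n))
  τ′ (node (node a b) (node c d)) = node (node a c) (node b d)
  ∧-swapˡ : ∀ a b c → a ∧ (b ∧ c) ≡ b ∧ (a ∧ c)
  ∧-swapˡ a b c = ≡-trans (sym (∧-assoc a b c)) (≡-trans (cong (_∧ c) (∧-comm a b)) (∧-assoc b a c))
  mem : ∀ S M → memᵇ (σ′ S) (τ′ M) ≡ memᵇ S M
  mem (false ∷ false ∷ S) (node (node a b) (node c d)) = refl
  mem (false ∷ true ∷ S)  (node (node a b) (node c d)) = refl
  mem (true ∷ false ∷ S)  (node (node a b) (node c d)) = refl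
  mem (true ∷ true ∷ S)   (node (node a b) (node c d)) = refl
  perm : ∀ M → elems (τ′ M) ↭ map σ′ (elems M)
  perm (node (node a b) (node c d)) = ↭-trans (↭-reflexive (elems-node² a c b d))
    (↭-trans middle (↭-reflexive (sym image)))
    where
    as = map (λ S → false ∷ false ∷ S) (elems a)
    bs = map (λ S → true ∷ false ∷ S) (elems b)
    cs = map (λ S → false ∷ true ∷ S) (elems c)
    ds = map (λ S → true ∷ true ∷ S) (elems d)
    middle : (as ++ cs) ++ (bs ++ ds) ↭ (as ++ bs) ++ (cs ++ ds)
    middle = ↭-trans (↭-reflexive (++-assoc as cs (bs ++ ds)))
      (↭-trans (++⁺ˡ as (shifts cs bs)) (↭-reflexive (sym (++-assoc as bs (cs ++ ds)))))
    half : ∀ x u v → map σ′ (map (λ S → x ∷ false ∷ S) u ++ map (λ S → x ∷ true ∷ S) v) ≡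
                     map (λ S → false ∷ x ∷ S) u ++ map (λ S → true ∷ x ∷ S) v
    half x u v = ≡-trans (map-++ σ′ (map (λ S → x ∷ false ∷ S) u) _)
                         (cong₂ _++_ (sym (map-∘ u)) (sym (map-∘ v)))
    image : map σ′ (elems (node (node a b) (node c d))) ≡ (as ++ bs) ++ (cs ++ ds)
    image = ≡-trans (cong (map σ′) (elems-node² a b c d))
      (≡-trans (map-++ σ′ (map (λ S → false ∷ false ∷ S) (elems a) ++ _) _)
               (cong₂ _++_ (half false (elems a) (elems b)) (half true (elems c) (elems d))))
  ∑⁴ : (PSet n → PSet n → PSet n → PSet n → ℕ) → ℕ
  ∑⁴ g = ∑ (allPSets n) (λ a → ∑ (allPSets n) (λ b → ∑ (allPSets n) (λ c → ∑ (allPSets n) (λ d → g a b c d))))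
  unfold : ∀ f → ∑ (allPSets (suc (suc n))) f ≡ ∑⁴ (λ a b c d → f (node (node a b) (node c d)))
  unfold f = begin
    ∑ (allPSets (suc (suc n))) f
      ≡⟨ ∑-allPSets (suc n) f ⟩
    ∑ (allPSets (suc n)) (λ l → ∑ (allPSets (suc n)) (λ r → f (node l r)))
      ≡⟨ ∑-allPSets n _ ⟩
    ∑ (allPSets n) (λ a → ∑ (allPSets n) (λ b → ∑ (allPSets (suc n)) (λ r → f (node (node a b) r))))
      ≡⟨ ∑-cong (allPSets n) (λ a → ∑-cong (allPSets n) (λ b → ∑-allPSets n _)) ⟩
    ∑⁴ (λ a b c d → f (node (node a b) (node c d))) ∎
    where open ≡-Reasoning
  measure : ∀ f → ∑ (allPSets (suc (suc n))) (f ∘ τ′) ≡ ∑ (allPSets (suc (suc n))) f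
  measure f = begin
    ∑ (allPSets (suc (suc n))) (f ∘ τ′)
      ≡⟨ unfold (f ∘ τ′) ⟩
    ∑⁴ (λ a b c d → f (node (node a c) (node b d)))
      ≡⟨ ∑-cong (allPSets n) (λ a → ∑-swap (allPSets n) (allPSets n) _) ⟩
    ∑⁴ (λ a c b d → f (node (node a c) (node b d)))
      ≡⟨ unfold f ⟨
    ∑ (allPSets (suc (suc n))) f ∎
    where open ≡-Reasoning

-- Transitivity of the symmetries on sets of equal size

initialSegment : ∀ n → ℕ → Subset n
initialSegment zero    k       = []
initialSegment (suc n) zero    = false ∷ initialSegment n zero
initialSegment (suc n) (suc k) = true ∷ initialSegment n k

-- An insertion step: one swap carries the absent element past the leading present one, and the rest
-- of the journey takes place under `liftₛ`.
insert-false : ∀ n k → k ≤ n →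
  ∃ λ s → σ s (false ∷ initialSegment n k) ≡ initialSegment (suc n) k
insert-false n       zero    _         = idₛ , refl
insert-false (suc n) (suc k) (s≤s k≤n) with insert-false n k k≤n
... | s , eq = liftₛ s ∘ₛ swapₛ , cong (true ∷_) eq

-- Insertion sort of the characteristic vector. Any two sets of the same size thus reach the same
-- normal form.
to-initialSegment : (S : Subset n) → ∃ λ s → σ s S ≡ initialSegment n ∣ S ∣
to-initialSegment []          = idₛ , refl
to-initialSegment (true ∷ S)  with to-initialSegment S
... | s , eq = liftₛ s , cong (true ∷_) eq
to-initialSegment {suc n} (false ∷ S) with to-initialSegment S | insert-false n ∣ S ∣ (∣p∣≤n S)
... | s , eq | s′ , eq′ = s′ ∘ₛ liftₛ s , ≡-trans (cong (σ s′ ∘ (false ∷_)) eq) eq′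

-- Counting collections

valids : ∀ n → ℕ → ℕ → List (PSet n)
valids n k q = filter (λ M → T? (validᵇ k q M)) (allPSets n)

valids-unique : ∀ n k q → Unique (valids n k q)
valids-unique n k q = Uniqueₚ.filter⁺ (λ M → T? (validᵇ k q M)) (allPSets-unique n)

valids-valid : ∀ n k q → All (λ M → T (validᵇ k q M)) (valids n k q)
valids-valid n k q = all-filter (λ M → T? (validᵇ k q M)) (allPSets n)

valid⇒length : ∀ k q (M : PSet n) → T (validᵇ k q M) → length (elems M) ≡ k
valid⇒length k q M v = ≡ᵇ⇒≡ _ k (proj₁ (Equivalence.to T-∧ v))

valid⇒size : ∀ k q (M : PSet n) → T (validᵇ k q M) → ∀ S → S ∈ₚ M → ∣ S ∣ ≡ q
valid⇒size k q M v S S∈M = ≡ᵇ⇒≡ _ q (All.lookup (all⁺ (λ S → ∣ S ∣ ≡ᵇ q) (elems M) sizes) (∈ₚ⇒∈-elems S M S∈M))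
  where sizes = proj₁ (Equivalence.to T-∧ (proj₂ (Equivalence.to (T-∧ {length (elems M) ≡ᵇ k}) v)))

module _ (n k q : ℕ) where

  containing : Subset n → ℕ
  containing S = ∑ (valids n k q) (λ M → ⟦ memᵇ S M ⟧)

  -- After reindexing by `τ`, validity and membership are both invariant. The filter is first
  -- rewritten as an indicator weight because `τ-measure` speaks of sums over all of `allPSets`.
  containing-σ : ∀ s S → containing (σ s S) ≡ containing S
  containing-σ s S = begin
    containing (σ s S)
      ≡⟨ ∑-filter (validᵇ k q) (allPSets n) _ ⟩
    ∑ (allPSets n) (λ M → ⟦ validᵇ k q M ⟧ * ⟦ memᵇ (σ s S) M ⟧)
      ≡⟨ τ-measure s _ ⟨
    ∑ (allPSets n) (λ M → ⟦ validᵇ k q (τ s M) ⟧ * ⟦ memᵇ (σ s S) (τ s M) ⟧)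
      ≡⟨ ∑-cong (allPSets n) (λ M → cong₂ (λ a b → ⟦ a ⟧ * ⟦ b ⟧) (validᵇ-τ s k q M) (σ-mem s S M)) ⟩
    ∑ (allPSets n) (λ M → ⟦ validᵇ k q M ⟧ * ⟦ memᵇ S M ⟧)
      ≡⟨ ∑-filter (validᵇ k q) (allPSets n) _ ⟨
    containing S ∎
    where open ≡-Reasoning

  containing-size : ∀ S → containing S ≡ containing (initialSegment n ∣ S ∣)
  containing-size S with to-initialSegment S
  ... | s , eq = ≡-trans (sym (containing-σ s S)) (cong containing eq)

  ∑-containing : ∀ W → ∑ (kSubsets W q) containing ≡ (∣ W ∣ C q) * containing (initialSegment n q)
  ∑-containing W = ≡-trans
    (∑-const (kSubsets W q)
      (All.map (λ {S} size → ≡-trans (containing-size S) (cong (containing ∘ initialSegment n) size))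
               (kSubsets-size W q)))
    (cong (_* containing (initialSegment n q)) (length-kSubsets W q))

  containing-≤ : (n C q) * containing (initialSegment n q) ≤ length (valids n k q) * k
  containing-≤ = begin
    (n C q) * containing (initialSegment n q)
      ≡⟨ cong (λ m → (m C q) * containing (initialSegment n q)) (∣⊤∣≡n n) ⟨
    (∣ ⊤ {n} ∣ C q) * containing (initialSegment n q)
      ≡⟨ ∑-containing ⊤ ⟨
    ∑ (kSubsets ⊤ q) containing
      ≡⟨ ∑-swap (kSubsets ⊤ q) (valids n k q) (λ S M → ⟦ memᵇ S M ⟧) ⟩
    ∑ (valids n k q) (λ M → ∑ (kSubsets ⊤ q) (λ S → ⟦ memᵇ S M ⟧))
      ≤⟨ ∑-≤-const (valids n k q)
           (All.map (λ {M} v → ≤-trans (∑-memᵇ≤length-elems ⊤ q M) (≤-reflexive (valid⇒length k q M v)))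
                    (valids-valid n k q)) ⟩
    length (valids n k q) * k ∎
    where open ≤-Reasoning

-- Frequency of a block inside a given set

hitsᵇ : ℕ → Subset n → PSet n → Bool
hitsᵇ q W M = any (λ S → memᵇ S M) (kSubsets W q)

hitsᵇ-complete : ∀ k q (W S : Subset n) M → T (validᵇ k q M) → S ⊆ W → S ∈ₚ M → T (hitsᵇ q W M)
hitsᵇ-complete k q W S M v S⊆W S∈M =
  any⁺ (λ S → memᵇ S M) (lose (subst (λ k → S ∈ˡ kSubsets W k) (valid⇒size k q M v S S∈M)
                                            (kSubsets-complete S W S⊆W))
                                   (∈ₚ⇒memᵇ S M S∈M))

-- The union bound over the q-subsets of W gives C(w,q) times the common frequency `c` of a q-set,
-- where w = ∣W∣. The double count over the whole ground set bounds C(n,q) times the same `c` by the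
-- total number of blocks. Eliminating `c` leaves the ratio C(w,q)/C(n,q), which is at most (w/n)^q.
∑-hitsᵇ-≤ : ∀ n k q (W : Subset n) →
  ∑ (valids n k q) (λ M → ⟦ hitsᵇ q W M ⟧) * n ^ q ≤ ∣ W ∣ ^ q * (length (valids n k q) * k)
∑-hitsᵇ-≤ n k q W = begin
  ∑ (valids n k q) (λ M → ⟦ hitsᵇ q W M ⟧) * n ^ q
    ≤⟨ *-monoˡ-≤ (n ^ q) (∑-mono (valids n k q) (λ M → ∑-⟦⟧-any (λ S → memᵇ S M) (kSubsets W q))) ⟩
  ∑ (valids n k q) (λ M → ∑ (kSubsets W q) (λ S → ⟦ memᵇ S M ⟧)) * n ^ q
    ≡⟨ cong (_* n ^ q) (∑-swap (valids n k q) (kSubsets W q) (λ M S → ⟦ memᵇ S M ⟧)) ⟩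
  ∑ (kSubsets W q) (containing n k q) * n ^ q
    ≡⟨ cong (_* n ^ q) (∑-containing n k q W) ⟩
  (∣ W ∣ C q) * c * n ^ q
    ≡⟨ rotate (∣ W ∣ C q) c (n ^ q) ⟩
  (∣ W ∣ C q) * n ^ q * c
    ≤⟨ *-monoˡ-≤ c ratio ⟩
  ∣ W ∣ ^ q * (n C q) * c
    ≡⟨ *-assoc (∣ W ∣ ^ q) (n C q) c ⟩
  ∣ W ∣ ^ q * ((n C q) * c)
    ≤⟨ *-monoʳ-≤ (∣ W ∣ ^ q) (containing-≤ n k q) ⟩
  ∣ W ∣ ^ q * (length (valids n k q) * k) ∎
  where
  open ≤-Reasoning
  c = containing n k q (initialSegment n q)
  rotate : ∀ a b c → a * b * c ≡ a * c * b
  rotate = solve-∀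
  ratio : (∣ W ∣ C q) * n ^ q ≤ ∣ W ∣ ^ q * (n C q)
  ratio = subst (λ z → (∣ W ∣ C q) * z ^ q ≤ ∣ W ∣ ^ q * (n C q)) (+-identityʳ n)
         (subst (λ z → (∣ W ∣ C q) * (n + 0) ^ q ≤ z ^ q * (n C q)) (+-identityʳ ∣ W ∣)
                (C-ratio-≤ q 0 (∣p∣≤n W)))

-- The number `k` of blocks is traded for one factor n of the denominator, whose exponent thereby
-- becomes one less than the block size.
∑-hitsᵇ-≤′ : ∀ n k q .{{_ : NonZero n}} (W : Subset n) → k ≤ n →
  ∑ (valids n k (suc q)) (λ M → ⟦ hitsᵇ (suc q) W M ⟧) * n ^ q ≤ ∣ W ∣ ^ suc q * length (valids n k (suc q))
∑-hitsᵇ-≤′ n k q W k≤n = *-cancelʳ-≤ _ _ n (begin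
  H * n ^ q * n            ≡⟨ rotate H (n ^ q) n ⟩
  H * n ^ suc q            ≤⟨ ∑-hitsᵇ-≤ n k (suc q) W ⟩
  ∣ W ∣ ^ suc q * (Z * k)  ≤⟨ *-monoʳ-≤ (∣ W ∣ ^ suc q) (*-monoʳ-≤ Z k≤n) ⟩
  ∣ W ∣ ^ suc q * (Z * n)  ≡⟨ *-assoc (∣ W ∣ ^ suc q) Z n ⟨
  ∣ W ∣ ^ suc q * Z * n    ∎)
  where
  open ≤-Reasoning
  H = ∑ (valids n k (suc q)) (λ M → ⟦ hitsᵇ (suc q) W M ⟧)
  Z = length (valids n k (suc q))
  rotate : ∀ a b c → a * b * c ≡ a * (c * b)
  rotate = solve-∀

-- Independent samples

length-cartesianProductWith : ∀ {C : Set ℓ} (h : A → B → C) xs ys →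
  length (cartesianProductWith h xs ys) ≡ length xs * length ys
length-cartesianProductWith h []       ys = refl
length-cartesianProductWith h (x ∷ xs) ys = ≡-trans (length-++ (map (h x) ys))
  (cong₂ _+_ (length-map (h x) ys) (length-cartesianProductWith h xs ys))

vecs : List A → ∀ m → List (Vec A m)
vecs xs zero    = [] ∷ []
vecs xs (suc m) = cartesianProductWith _∷_ xs (vecs xs m)

length-vecs : ∀ (xs : List A) m → length (vecs xs m) ≡ length xs ^ m
length-vecs xs zero    = refl
length-vecs xs (suc m) = ≡-trans (length-cartesianProductWith _∷_ xs (vecs xs m))
                                 (cong (length xs *_) (length-vecs xs m))

vecs-unique : ∀ {xs : List A} → Unique xs → ∀ m → Unique (vecs xs m)
vecs-unique u zero    = [] ∷ []
vecs-unique u (suc m) = Uniqueₚ.cartesianProductWith⁺ _∷_ (λ { refl → refl , refl }) u (vecs-unique u m)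

vecs-all : ∀ {P : A → Set} {xs} → All P xs → ∀ m → All (Vecₐ.All P) (vecs xs m)
vecs-all ps zero = Vecₐ.[] ∷ []
vecs-all {P = P} {xs = xs} ps (suc m) = go ps
  where
  go : ∀ {ys} → All P ys → All (Vecₐ.All P) (cartesianProductWith _∷_ ys (vecs xs m))
  go []         = []
  go (py ∷ pys) = Allₚ.++⁺ (Allₚ.map⁺ (All.map (py Vecₐ.∷_) (vecs-all ps m))) (go pys)

everyᵇ : Subset n → (A → Bool) → Vec A n → Bool
everyᵇ []          p []      = true
everyᵇ (false ∷ D) p (x ∷ ω) = everyᵇ D p ω
everyᵇ (true ∷ D)  p (x ∷ ω) = p x ∧ everyᵇ D p ω

everyᵇ-complete : ∀ (D : Subset n) (p : A → Bool) ω → (∀ i → i ∈ D → T (p (lookup ω i))) → T (everyᵇ D p ω)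
everyᵇ-complete []          p []      h = _
everyᵇ-complete (false ∷ D) p (x ∷ ω) h = everyᵇ-complete D p ω (λ i i∈D → h (suc i) (Data.Vec.there i∈D))
everyᵇ-complete (true ∷ D)  p (x ∷ ω) h = Equivalence.from T-∧
  (h zero Data.Vec.here , everyᵇ-complete D p ω (λ i i∈D → h (suc i) (Data.Vec.there i∈D)))

-- Independence in counting form: if `p` has probability at most b/a, then it holds at all
-- coordinates of D with probability at most (b/a)^∣D∣. The sum over vectors factorises; a
-- coordinate in D contributes the hypothesis `Pp`, any other a full factor `length xs`.
∑-everyᵇ-≤ : ∀ (xs : List A) (p : A → Bool) a b → ∑ xs (⟦_⟧ ∘ p) * a ≤ b * length xs → ∀ (D : Subset n) →
  ∑ (vecs xs n) (λ ω → ⟦ everyᵇ D p ω ⟧) * a ^ ∣ D ∣ ≤ b ^ ∣ D ∣ * length xs ^ n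
∑-everyᵇ-≤ xs p a b Pp []                  = ≤-refl
∑-everyᵇ-≤ {n = suc n} xs p a b Pp (false ∷ D) = begin
  ∑ (vecs xs (suc n)) (λ ω → ⟦ everyᵇ (false ∷ D) p ω ⟧) * a ^ ∣ D ∣
    ≡⟨ cong (_* a ^ ∣ D ∣) (∑-cartesianProductWith _∷_ xs (vecs xs n) _) ⟩
  ∑ xs (λ _ → E) * a ^ ∣ D ∣
    ≡⟨ cong (_* a ^ ∣ D ∣) (∑-const xs (All.universal (λ _ → refl) xs)) ⟩
  length xs * E * a ^ ∣ D ∣
    ≡⟨ *-assoc (length xs) E _ ⟩
  length xs * (E * a ^ ∣ D ∣)
    ≤⟨ *-monoʳ-≤ (length xs) (∑-everyᵇ-≤ xs p a b Pp D) ⟩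
  length xs * (b ^ ∣ D ∣ * length xs ^ n)
    ≡⟨ swapˡ (length xs) (b ^ ∣ D ∣) _ ⟩
  b ^ ∣ D ∣ * length xs ^ suc n ∎
  where
  open ≤-Reasoning
  E = ∑ (vecs xs n) (λ ω → ⟦ everyᵇ D p ω ⟧)
  swapˡ : ∀ a b c → a * (b * c) ≡ b * (a * c)
  swapˡ = solve-∀
∑-everyᵇ-≤ {n = suc n} xs p a b Pp (true ∷ D)  = begin
  ∑ (vecs xs (suc n)) (λ ω → ⟦ everyᵇ (true ∷ D) p ω ⟧) * a ^ suc ∣ D ∣
    ≡⟨ cong (_* a ^ suc ∣ D ∣) (∑-cartesianProductWith _∷_ xs (vecs xs n) _) ⟩
  ∑ xs (λ x → ∑ (vecs xs n) (λ ω → ⟦ p x ∧ everyᵇ D p ω ⟧)) * a ^ suc ∣ D ∣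
    ≡⟨ cong (_* a ^ suc ∣ D ∣) (∑-cong xs split) ⟩
  ∑ xs (λ x → ⟦ p x ⟧ * E) * a ^ suc ∣ D ∣
    ≡⟨ cong (_* a ^ suc ∣ D ∣) (∑-*ʳ xs (⟦_⟧ ∘ p) E) ⟨
  ∑ xs (⟦_⟧ ∘ p) * E * (a * a ^ ∣ D ∣)
    ≡⟨ [m*n]*[o*p]≡[m*o]*[n*p] (∑ xs (⟦_⟧ ∘ p)) E a _ ⟩
  ∑ xs (⟦_⟧ ∘ p) * a * (E * a ^ ∣ D ∣)
    ≤⟨ *-mono-≤ Pp (∑-everyᵇ-≤ xs p a b Pp D) ⟩
  b * length xs * (b ^ ∣ D ∣ * length xs ^ n)
    ≡⟨ [m*n]*[o*p]≡[m*o]*[n*p] b (length xs) (b ^ ∣ D ∣) _ ⟩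
  b ^ suc ∣ D ∣ * length xs ^ suc n ∎
  where
  open ≤-Reasoning
  E = ∑ (vecs xs n) (λ ω → ⟦ everyᵇ D p ω ⟧)
  split : ∀ x → ∑ (vecs xs n) (λ ω → ⟦ p x ∧ everyᵇ D p ω ⟧) ≡ ⟦ p x ⟧ * E
  split x with p x
  ... | true  = sym (+-identityʳ E)
  ... | false = ∑-zero (vecs xs n)

-- Spanning sets

∣p∪q∣≤∣p∣+∣q∣ : ∀ (p q : Subset n) → ∣ p ∪ q ∣ ≤ ∣ p ∣ + ∣ q ∣
∣p∪q∣≤∣p∣+∣q∣ []          []          = z≤n
∣p∪q∣≤∣p∣+∣q∣ (false ∷ p) (false ∷ q) = ∣p∪q∣≤∣p∣+∣q∣ p q
∣p∪q∣≤∣p∣+∣q∣ (false ∷ p) (true ∷ q)  rewrite +-suc ∣ p ∣ ∣ q ∣ = s≤s (∣p∪q∣≤∣p∣+∣q∣ p q)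
∣p∪q∣≤∣p∣+∣q∣ (true ∷ p)  (false ∷ q) = s≤s (∣p∪q∣≤∣p∣+∣q∣ p q)
∣p∪q∣≤∣p∣+∣q∣ (true ∷ p)  (true ∷ q)  =
  s≤s (≤-trans (∣p∪q∣≤∣p∣+∣q∣ p q) (+-monoʳ-≤ ∣ p ∣ (n≤1+n ∣ q ∣)))

x∉p⇒∣p∪⁅x⁆∣≡1+∣p∣ : ∀ (p : Subset n) x → x ∉ p → ∣ p ∪ ⁅ x ⁆ ∣ ≡ suc ∣ p ∣
x∉p⇒∣p∪⁅x⁆∣≡1+∣p∣ (false ∷ p) zero    x∉p = cong (suc ∘ ∣_∣) (∪-identityʳ p)
x∉p⇒∣p∪⁅x⁆∣≡1+∣p∣ (true ∷ p)  zero    x∉p = ⊥-elim (x∉p Data.Vec.here)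
x∉p⇒∣p∪⁅x⁆∣≡1+∣p∣ (false ∷ p) (suc x) x∉p = x∉p⇒∣p∪⁅x⁆∣≡1+∣p∣ p x (x∉p ∘ Data.Vec.there)
x∉p⇒∣p∪⁅x⁆∣≡1+∣p∣ (true ∷ p)  (suc x) x∉p = cong suc (x∉p⇒∣p∪⁅x⁆∣≡1+∣p∣ p x (x∉p ∘ Data.Vec.there))

∣p∣<n⇒∃∉ : ∀ (p : Subset n) → ∣ p ∣ < n → ∃ λ i → i ∉ p
∣p∣<n⇒∃∉ (false ∷ p) _        = zero , λ ()
∣p∣<n⇒∃∉ (true ∷ p)  (s≤s p<) with ∣p∣<n⇒∃∉ p p<
... | i , i∉p = suc i , i∉p ∘ drop-there

-- A derivation that starts inside U and ends outside must leave U somewhere. At the first such step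
-- everything derived so far still lies in U, and so does the premise of the rule.
leaves : ∀ {𝒮 : Spanoid n} {T U i} → T ⊆ U → i ∉ U → 𝒮 ⊢ T ⊨ i →
         ∃ λ j → j ∉ U × ∃ λ S → S ⊆ U × 𝒮 S j
leaves T⊆U i∉U (here i∈T) = ⊥-elim (i∉U (T⊆U i∈T))
leaves {T = T} {U} T⊆U i∉U (step j S S⊆T rule rest) with j ∈? U
... | no j∉U  = j , j∉U , S , T⊆U ∘ S⊆T , rule
... | yes j∈U = leaves T∪j⊆U i∉U rest
  where
  T∪j⊆U : T ∪ ⁅ j ⁆ ⊆ U
  T∪j⊆U x∈ with x∈p∪q⁻ T ⁅ j ⁆ x∈
  ... | inj₁ x∈T = T⊆U x∈T
  ... | inj₂ x∈j = subst (_∈ U) (sym (x∈⁅y⁆⇒x≡y j x∈j)) j∈U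

-- D grows by one element at a time. As ∣T∣ + d ≤ n, some `i` is still missing from T ∪ D, and its
-- derivation leaves T ∪ D by a rule with premise inside and conclusion `j` outside. Earlier
-- supports persist when D grows, so in the end all of them lie in the same final set.
spans⇒supported : ∀ {𝒮 : Spanoid n} {T} → Spans 𝒮 T → ∀ d → ∣ T ∣ + d ≤ n →
  ∃ λ D → ∣ D ∣ ≡ d × (∀ i → i ∈ D → ∃ λ S → S ⊆ T ∪ D × 𝒮 S i)
spans⇒supported {n} spans zero    _  = ⊥ , ∣⊥∣≡0 n , λ i i∈⊥ → ⊥-elim (∉⊥ i∈⊥)
spans⇒supported {n} {𝒮} {T} spans (suc d) le
  with spans⇒supported spans d (≤-trans (+-monoʳ-≤ ∣ T ∣ (n≤1+n d)) le)
... | D , refl , supp with ∣p∣<n⇒∃∉ (T ∪ D) (≤-trans (s≤s (∣p∪q∣≤∣p∣+∣q∣ T D))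
                                                   (subst (_≤ n) (+-suc ∣ T ∣ ∣ D ∣) le))
... | i , i∉ with leaves (p⊆p∪q D) i∉ (spans i)
... | j , j∉ , S , S⊆ , rule =
  D ∪ ⁅ j ⁆ , x∉p⇒∣p∪⁅x⁆∣≡1+∣p∣ D j (j∉ ∘ q⊆p∪q T D) , supp′
  where
  enlarge : T ∪ D ⊆ T ∪ (D ∪ ⁅ j ⁆)
  enlarge x∈ with x∈p∪q⁻ T D x∈
  ... | inj₁ x∈T = p⊆p∪q (D ∪ ⁅ j ⁆) x∈T
  ... | inj₂ x∈D = q⊆p∪q T (D ∪ ⁅ j ⁆) (p⊆p∪q ⁅ j ⁆ x∈D)
  supp′ : ∀ i → i ∈ D ∪ ⁅ j ⁆ → ∃ λ S → S ⊆ T ∪ (D ∪ ⁅ j ⁆) × 𝒮 S i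
  supp′ i i∈ with x∈p∪q⁻ D ⁅ j ⁆ i∈
  ... | inj₂ i∈j with refl ← x∈⁅y⁆⇒x≡y j i∈j = S , enlarge ∘ S⊆ , rule
  ... | inj₁ i∈D with supp i i∈D
  ...   | S′ , S′⊆ , rule′ = S′ , enlarge ∘ S′⊆ , rule′

-- The union bound

-- T is a candidate spanning set and D consists of the first d elements derived from it.
badᵇ : ℕ → ℕ → ℕ → Vec (PSet n) n → Bool
badᵇ {n} q t d ω =
  any (λ T → any (λ D → everyᵇ D (hitsᵇ q (T ∪ D)) ω) (kSubsets ⊤ d)) (subsetsUpTo n t)

-- The base `2 * d` bounds ∣T ∪ D∣ ≤ t + d. Once T and D are fixed, the events for the different i ∈
-- D concern different coordinates of `ω`, so `∑-everyᵇ-≤` applies to each pair.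
∑-badᵇ-≤ : ∀ n k p t d .{{_ : NonZero n}} → k ≤ n → t ≤ d →
  ∑ (vecs (valids n k (suc p)) n) (λ ω → ⟦ badᵇ (suc p) t d ω ⟧) * (n ^ p) ^ d
    ≤ suc n ^ t * ((n C d) * (((2 * d) ^ suc p) ^ d * length (valids n k (suc p)) ^ n))
∑-badᵇ-≤ n k p t d k≤n t≤d = begin
  ∑ Ω (λ ω → ⟦ badᵇ q t d ω ⟧) * a ^ d
    ≤⟨ *-monoˡ-≤ (a ^ d) (∑-mono Ω (λ ω → ≤-trans
         (∑-⟦⟧-any (λ T → any (λ D → everyᵇ D (hitsᵇ q (T ∪ D)) ω) Ds) Ts)
         (∑-mono Ts (λ T → ∑-⟦⟧-any (λ D → everyᵇ D (hitsᵇ q (T ∪ D)) ω) Ds)))) ⟩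
  ∑ Ω (λ ω → ∑ Ts (λ T → ∑ Ds (λ D → ⟦ everyᵇ D (hitsᵇ q (T ∪ D)) ω ⟧))) * a ^ d
    ≡⟨ cong (_* a ^ d) (∑-swap Ω Ts _) ⟩
  ∑ Ts (λ T → ∑ Ω (λ ω → ∑ Ds (λ D → ⟦ everyᵇ D (hitsᵇ q (T ∪ D)) ω ⟧))) * a ^ d
    ≡⟨ cong (_* a ^ d) (∑-cong Ts (λ T → ∑-swap Ω Ds _)) ⟩
  ∑ Ts (λ T → ∑ Ds (λ D → event T D)) * a ^ d
    ≡⟨ ∑-*ʳ Ts _ (a ^ d) ⟩
  ∑ Ts (λ T → ∑ Ds (event T) * a ^ d)
    ≤⟨ ∑-≤-const Ts (All.map (λ {T} → sum-over-D T) (subsetsUpTo-size n t)) ⟩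
  length Ts * (length Ds * X)
    ≤⟨ *-monoˡ-≤ (length Ds * X) (length-subsetsUpTo n t) ⟩
  suc n ^ t * (length Ds * X)
    ≡⟨ cong (λ z → suc n ^ t * (z * X)) (≡-trans (length-kSubsets (⊤ {n}) d) (cong (_C d) (∣⊤∣≡n n))) ⟩
  suc n ^ t * ((n C d) * X) ∎
  where
  open ≤-Reasoning
  q = suc p
  a = n ^ p
  b = (2 * d) ^ q
  V = valids n k q
  Ω = vecs V n
  Ts = subsetsUpTo n t
  Ds = kSubsets (⊤ {n}) d
  X = b ^ d * length V ^ n
  event : Subset n → Subset n → ℕ
  event T D = ∑ Ω (λ ω → ⟦ everyᵇ D (hitsᵇ q (T ∪ D)) ω ⟧)
  hit-≤ : ∀ T D → ∣ T ∣ ≤ t → ∣ D ∣ ≡ d → ∑ V (λ M → ⟦ hitsᵇ q (T ∪ D) M ⟧) * a ≤ b * length V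
  hit-≤ T D T≤ refl = ≤-trans (∑-hitsᵇ-≤′ n k p (T ∪ D) k≤n)
    (*-monoˡ-≤ (length V) (^-monoˡ-≤ q (≤-trans (∣p∪q∣≤∣p∣+∣q∣ T D)
      (+-mono-≤ (≤-trans T≤ t≤d) (≤-reflexive (sym (+-identityʳ d)))))))
  event-≤ : ∀ T D → ∣ T ∣ ≤ t → ∣ D ∣ ≡ d → event T D * a ^ d ≤ X
  event-≤ T D T≤ D≡ = subst (λ e → event T D * a ^ e ≤ b ^ e * length V ^ n) D≡
    (∑-everyᵇ-≤ V (hitsᵇ q (T ∪ D)) a b (hit-≤ T D T≤ D≡) D)
  sum-over-D : ∀ T → ∣ T ∣ ≤ t → ∑ Ds (event T) * a ^ d ≤ length Ds * X
  sum-over-D T T≤ = ≤-trans (≤-reflexive (∑-*ʳ Ds (event T) (a ^ d)))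
    (∑-≤-const Ds (All.map (λ {D} → event-≤ T D T≤) (kSubsets-size ⊤ d)))

-- The scale t is calibrated for base n, while the sets T are counted with base n + 1. Replacing n +
-- 1 by n² doubles the exponent, which turns 2^d into 4^d.
[1+n]^t≤4^d : ∀ n t d → 2 ≤ n → n ^ t ≤ 2 ^ d → suc n ^ t ≤ 4 ^ d
[1+n]^t≤4^d n t d 2≤n n^t≤2^d = begin
  suc n ^ t        ≤⟨ ^-monoˡ-≤ t 1+n≤n*n ⟩
  (n * n) ^ t      ≡⟨ *-^-distrib n n t ⟩
  n ^ t * n ^ t    ≤⟨ *-mono-≤ n^t≤2^d n^t≤2^d ⟩
  2 ^ d * 2 ^ d    ≡⟨ *-^-distrib 2 2 d ⟨
  4 ^ d            ∎
  where
  open ≤-Reasoning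
  1+n≤n*n : suc n ≤ n * n
  1+n≤n*n = begin
    1 + n          ≤⟨ +-monoˡ-≤ n (<⇒≤ 2≤n) ⟩
    n + n          ≡⟨ cong (n +_) (+-identityʳ n) ⟨
    2 * n          ≤⟨ *-monoˡ-≤ n 2≤n ⟩
    n * n          ∎

∑-badᵇ*2^d≤ : ∀ n k r t d → 2 ≤ n → 1 ≤ r → 1 ≤ d → k ≤ n → t ≤ d →
  n ^ t ≤ 2 ^ d → (32 * d) ^ suc r ≤ n ^ r →
  ∑ (vecs (valids n k (suc (suc r))) n) (λ ω → ⟦ badᵇ (suc (suc r)) t d ω ⟧) * 2 ^ d
    ≤ length (valids n k (suc (suc r))) ^ n
∑-badᵇ*2^d≤ n k r t d 2≤n 1≤r 1≤d k≤n t≤d n^t≤2^d d-small =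
  -- The multiplier supplies `a ^ d` for the event bound and `d ^ d` for the binomial estimate
  -- `nCk*k^k≤[4n]^k`.
  *-cancelʳ-≤ (#bad * 2 ^ d) Y ((a * d) ^ d) {{m^n≢0 (a * d) d {{m*n≢0 a d {{m^n≢0 n (suc r)}}}}}} (begin
  #bad * 2 ^ d * (a * d) ^ d                        ≡⟨ cong (#bad * 2 ^ d *_) (*-^-distrib a d d) ⟩
  #bad * 2 ^ d * (a ^ d * d ^ d)                    ≡⟨ gather #bad (2 ^ d) (a ^ d) (d ^ d) ⟩
  #bad * a ^ d * (2 ^ d * d ^ d)                    ≤⟨ *-monoˡ-≤ (2 ^ d * d ^ d) (∑-badᵇ-≤ n k (suc r) t d k≤n t≤d) ⟩
  suc n ^ t * ((n C d) * (b ^ d * Y)) * (2 ^ d * d ^ d)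
    ≡⟨ gather′ (suc n ^ t) (n C d) (b ^ d) Y (2 ^ d) (d ^ d) ⟩
  suc n ^ t * ((n C d) * d ^ d) * (2 ^ d * b ^ d) * Y
    ≤⟨ *-monoˡ-≤ Y (*-monoˡ-≤ (2 ^ d * b ^ d)
         (*-mono-≤ ([1+n]^t≤4^d n t d 2≤n n^t≤2^d) (nCk*k^k≤[4n]^k n d))) ⟩
  4 ^ d * (4 * n) ^ d * (2 ^ d * b ^ d) * Y
    ≡⟨ cong (_* Y) (cong₂ _*_ (*-^-distrib 4 (4 * n) d) (*-^-distrib 2 b d)) ⟨
  (4 * (4 * n)) ^ d * (2 * b) ^ d * Y            ≡⟨ cong (_* Y) (*-^-distrib (4 * (4 * n)) (2 * b) d) ⟨
  (4 * (4 * n) * (2 * b)) ^ d * Y                ≤⟨ *-monoˡ-≤ Y (^-monoˡ-≤ d base) ⟩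
  (a * d) ^ d * Y                                ≡⟨ *-comm ((a * d) ^ d) Y ⟩
  Y * (a * d) ^ d                                ∎)
  where
  open ≤-Reasoning
  q = suc (suc r)
  #bad = ∑ (vecs (valids n k q) n) (λ ω → ⟦ badᵇ q t d ω ⟧)
  Y = length (valids n k q) ^ n
  a = n ^ suc r
  b = (2 * d) ^ q
  instance
    n≢0 : NonZero n
    n≢0 = >-nonZero (<⇒≤ 2≤n)
    d≢0 : NonZero d
    d≢0 = >-nonZero 1≤d
  gather : ∀ b u a v → b * u * (a * v) ≡ b * a * (u * v)
  gather = solve-∀
  gather′ : ∀ s c b y u v → s * (c * (b * y)) * (u * v) ≡ s * (c * v) * (u * b) * y
  gather′ = solve-∀
  regroup : ∀ n d x → 4 * (4 * n) * (2 * (2 * d * x)) ≡ 64 * x * (n * d)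
  regroup = solve-∀
  -- The constant to absorb is 64 = 4 · 4 · 2 · 2: the choice of T, the choice of D, the margin 2^d,
  -- and the factor 2 left over from (2d)^q / d. Here q ≥ 3 enters as `1 ≤ r`.
  16²≤16^1+r : 256 ≤ 16 ^ suc r
  16²≤16^1+r = ^-monoʳ-≤ 16 (s≤s 1≤r)
  shrink : 64 * (2 * d) ^ suc r ≤ n ^ r
  shrink = begin
    64 * (2 * d) ^ suc r             ≤⟨ *-monoˡ-≤ ((2 * d) ^ suc r) (≤-trans (m≤m+n 64 192) 16²≤16^1+r) ⟩
    16 ^ suc r * (2 * d) ^ suc r     ≡⟨ *-^-distrib 16 (2 * d) (suc r) ⟨
    (16 * (2 * d)) ^ suc r           ≡⟨ cong (_^ suc r) (*-assoc 16 2 d) ⟨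
    (32 * d) ^ suc r                 ≤⟨ d-small ⟩
    n ^ r                            ∎
  base : 4 * (4 * n) * (2 * b) ≤ a * d
  base = begin
    4 * (4 * n) * (2 * (2 * d * (2 * d) ^ suc r))  ≡⟨ regroup n d ((2 * d) ^ suc r) ⟩
    64 * (2 * d) ^ suc r * (n * d)                 ≤⟨ *-monoˡ-≤ (n * d) shrink ⟩
    n ^ r * (n * d)                                ≡⟨ *-assoc (n ^ r) n d ⟨
    n ^ r * n * d                                  ≡⟨ cong (_* d) (*-comm (n ^ r) n) ⟩
    n ^ suc r * d                                  ∎

-- Large rank outside the bad event

T-not⇒¬T : ∀ b → T (not b) → ¬ T b
T-not⇒¬T false _ ()

n<2^n : ∀ n → n < 2 ^ n
n<2^n zero    = s≤s z≤n
n<2^n (suc n) = begin-strict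
  suc n             ≡⟨ +-comm 1 n ⟩
  n + 1             <⟨ +-mono-<-≤ (n<2^n n) (m^n>0 2 n) ⟩
  2 ^ n + 2 ^ n     ≡⟨ cong (2 ^ n +_) (+-identityʳ (2 ^ n)) ⟨
  2 ^ suc n         ∎
  where open ≤-Reasoning

-- A spanning set U of size at most t, together with a supported D of size d, would be one of the
-- pairs searched by `badᵇ`. The condition t + d ≤ n leaves room for D.
¬badᵇ⇒t<rank : ∀ k q t d (ω : Vec (PSet n) n) → Vecₐ.All (λ M → T (validᵇ k q M)) ω →
  ¬ T (badᵇ q t d ω) → t + d ≤ n → ∀ {U} → Spans (spanoidOf ω) U → t < ∣ U ∣
¬badᵇ⇒t<rank {n} k q t d ω valid ¬bad t+d≤n {U} spans = ≰⇒> absurd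
  where
  absurd : ¬ ∣ U ∣ ≤ t
  absurd U≤t with spans⇒supported spans d (≤-trans (+-monoˡ-≤ d U≤t) t+d≤n)
  ... | D , refl , supp = ¬bad (any⁺ _ (lose (subsetsUpTo-complete t U U≤t)
      (any⁺ _ (lose (kSubsets-complete D ⊤ ⊆⊤) (everyᵇ-complete D (hitsᵇ q (U ∪ D)) ω hit)))))
    where
    hit : ∀ i → i ∈ D → T (hitsᵇ q (U ∪ D) (lookup ω i))
    hit i i∈D with supp i i∈D
    ... | S , S⊆ , S∈ = hitsᵇ-complete k q (U ∪ D) S (lookup ω i) (Vecₐₚ.lookup⁺ valid i) S⊆ S∈

-- The rational number below log₂ n is d/ρ, because 2^d < n^(t+1) ≤ n^ρ. Multiplying it by the rank
-- ρ gives back d, so the claim reduces to n^r < (64d)^(r+1), which follows from the maximality of d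
-- and d + 1 ≤ 2d.
t<ρ⇒BigRank : ∀ n r t d ρ .{{_ : NonZero n}} → 1 ≤ d → t < ρ → 2 ^ d < n ^ suc t →
  n ^ r < (32 * suc d) ^ suc r → BigRank 1 64 (suc (suc r)) n ρ
t<ρ⇒BigRank n r t d ρ@(suc _) 1≤d t<ρ 2^d< d-large = d , ρ , s≤s z≤n , <-≤-trans 2^d< (^-monoʳ-≤ n t<ρ) , (begin-strict
  1 ^ suc r * n ^ r * ρ ^ suc r            ≡⟨ cong (λ z → z * n ^ r * ρ ^ suc r) (^-zeroˡ (suc r)) ⟩
  1 * n ^ r * ρ ^ suc r                    ≡⟨ cong (_* ρ ^ suc r) (*-identityˡ (n ^ r)) ⟩
  n ^ r * ρ ^ suc r                        <⟨ *-monoˡ-< (ρ ^ suc r) {{m^n≢0 ρ (suc r)}} n^r< ⟩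
  (d * 64) ^ suc r * ρ ^ suc r             ≡⟨ *-^-distrib (d * 64) ρ (suc r) ⟨
  (d * 64 * ρ) ^ suc r                     ≡⟨ cong (_^ suc r) (rotate d 64 ρ) ⟩
  (ρ * d * 64) ^ suc r                     ≡⟨ *-^-distrib (ρ * d) 64 (suc r) ⟩
  (ρ * d) ^ suc r * 64 ^ suc r             ∎)
  where
  open ≤-Reasoning
  rotate : ∀ a b c → a * b * c ≡ c * a * b
  rotate = solve-∀
  n^r< : n ^ r < (d * 64) ^ suc r
  n^r< = <-≤-trans d-large (^-monoˡ-≤ (suc r) (begin
    32 * suc d       ≤⟨ *-monoʳ-≤ 32 (+-monoˡ-≤ d 1≤d) ⟩
    32 * (d + d)     ≡⟨ double d ⟩
    d * 64           ∎))
    where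
    double : ∀ d → 32 * (d + d) ≡ d * 64
    double = solve-∀

-- Choice of the scales d and t

record Scales (r m n : ℕ) : Set where
  field
    d t     : ℕ
    m<d     : m < d
    t≤d     : t ≤ d
    t+d≤n   : t + d ≤ n
    n^t≤2^d : n ^ t ≤ 2 ^ d
    2^d<n^1+t : 2 ^ d < n ^ suc t
    d-small : (32 * d) ^ suc r ≤ n ^ r
    d-large : n ^ r < (32 * suc d) ^ suc r

-- The upper bounds on d and t feed the union bound, the lower bounds `d-large` and `2^d<n^1+t` feed
-- the rank estimate, and m < d pushes 2^-d below 1/(m+1). The threshold on n makes d = m + 1
-- admissible, since (32(m+1))^(r+1) ≤ n ≤ n^r.
scales : ∀ r m n → 1 ≤ r → 2 + (32 * suc m) ^ suc r ≤ n → Scales r m n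
scales r m n 1≤r N≤n = record
  { d = d ; t = t ; m<d = m<d ; t≤d = t≤d ; t+d≤n = t+d≤n ; n^t≤2^d = n^t≤2^d
  ; 2^d<n^1+t = ≰⇒> ¬n^1+t≤2^d ; d-small = d-small ; d-large = ≰⇒> ¬d-large }
  where
  open ≤-Reasoning
  2≤n : 2 ≤ n
  2≤n = ≤-trans (m≤m+n 2 _) N≤n
  instance
    n≢0 : NonZero n
    n≢0 = >-nonZero (<⇒≤ 2≤n)
  n^r≤n^1+r : n ^ r ≤ n ^ suc r
  n^r≤n^1+r = ^-monoʳ-≤ n (n≤1+n r)
  n<⇒n^r< : ∀ {x} → n < x → n ^ r < x ^ suc r
  n<⇒n^r< n<x = ≤-<-trans n^r≤n^1+r (^-monoˡ-< (suc r) n<x)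
  -- The search ends by d = m + 1 + n, where 32d already exceeds n.
  D-scale = last-true (λ d → (32 * d) ^ suc r ≤ n ^ r) (λ d → (32 * d) ^ suc r ≤? n ^ r) (suc m) n
    (begin
      (32 * suc m) ^ suc r       ≤⟨ m≤n+m _ 2 ⟩
      2 + (32 * suc m) ^ suc r   ≤⟨ N≤n ⟩
      n                          ≡⟨ *-identityʳ n ⟨
      n ^ 1                      ≤⟨ ^-monoʳ-≤ n 1≤r ⟩
      n ^ r                      ∎)
    (<⇒≱ (n<⇒n^r< (≤-trans (s≤s (m≤n+m n m)) (m≤m+n (suc m + n) _))))
  d = proj₁ D-scale
  m<d = proj₁ (proj₂ D-scale)
  d-small = proj₁ (proj₂ (proj₂ D-scale))
  ¬d-large = proj₂ (proj₂ (proj₂ D-scale))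
  -- The value d + 1 fails because n^(d+1) ≥ 2^(d+1) > 2^d.
  T-scale = last-true (λ t → n ^ t ≤ 2 ^ d) (λ t → n ^ t ≤? 2 ^ d) 0 (suc d) (m^n>0 2 d)
    (<⇒≱ (<-≤-trans (^-monoʳ-< 2 ≤-refl (n<1+n d)) (^-monoˡ-≤ (suc d) 2≤n)))
  t = proj₁ T-scale
  n^t≤2^d = proj₁ (proj₂ (proj₂ T-scale))
  ¬n^1+t≤2^d = proj₂ (proj₂ (proj₂ T-scale))
  t≤d : t ≤ d
  t≤d = ≮⇒≥ (λ d<t → <⇒≱ (^-monoʳ-< 2 ≤-refl d<t) (≤-trans (^-monoˡ-≤ t 2≤n) n^t≤2^d))
  32d≤n : 32 * d ≤ n
  32d≤n = ≮⇒≥ (λ n<32d → <⇒≱ (n<⇒n^r< n<32d) d-small)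
  t+d≤n : t + d ≤ n
  t+d≤n = begin
    t + d       ≤⟨ +-monoˡ-≤ d t≤d ⟩
    d + d       ≤⟨ +-monoʳ-≤ d (m≤m+n d (30 * d)) ⟩
    32 * d      ≤⟨ 32d≤n ⟩
    n           ∎

mainTheorem3 : ∃ λ a → ∃ λ b → 0 < a × a < b ×
    (∀ q → 3 ≤ q → ∀ m → ∃ λ N → ∀ n → N ≤ n →
    ∃ λ (L : List (Vec (PSet n) n)) →
    Unique L × All (Good a b q n) L × m * sampleSize n q ≤ suc m * length L)
mainTheorem3 = 1 , 64 , s≤s z≤n , s≤s (s≤s z≤n) , large
  where
  large : ∀ q → 3 ≤ q → ∀ m → ∃ λ N → ∀ n → N ≤ n →
    ∃ λ (L : List (Vec (PSet n) n)) →
    Unique L × All (Good 1 64 q n) L × m * sampleSize n q ≤ suc m * length L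
  large q@(suc (suc r)) (s≤s (s≤s 1≤r)) m = 2 + (32 * suc m) ^ suc r , sample
    where
    sample : ∀ n → 2 + (32 * suc m) ^ suc r ≤ n → ∃ λ (L : List (Vec (PSet n) n)) →
      Unique L × All (Good 1 64 q n) L × m * sampleSize n q ≤ suc m * length L
    sample n N≤n = L , Uniqueₚ.filter⁺ good? (vecs-unique (valids-unique n k q) n)
                     , All.zipWith good (valid-L , all-filter good? Ω) , size
      where
      open Scales (scales r m n 1≤r N≤n)
      k = numBlocks n q
      V = valids n k q
      Ω = vecs V n
      bad = badᵇ {n} q t d
      good? = λ ω → T? (not (bad ω))
      L = filter good? Ω
      #bad = ∑ Ω (⟦_⟧ ∘ bad)
      2≤n : 2 ≤ n
      2≤n = ≤-trans (m≤m+n 2 _) N≤n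
      1≤d : 1 ≤ d
      1≤d = ≤-trans (s≤s z≤n) m<d
      instance
        n≢0 : NonZero n
        n≢0 = >-nonZero (<⇒≤ 2≤n)
      valid-L : All (Vecₐ.All (λ M → T (validᵇ k q M))) L
      valid-L = Allₚ.filter⁺ good? (vecs-all (valids-valid n k q) n)
      good : ∀ {ω} → Vecₐ.All (λ M → T (validᵇ k q M)) ω × T (not (bad ω)) → Good 1 64 q n ω
      good {ω} (valid , ¬bad) = valid , big
        where
        big : ∀ ρ → IsRank (spanoidOf ω) ρ → BigRank 1 64 q n ρ
        big ρ ((U , spans , refl) , _) = t<ρ⇒BigRank n r t d ρ 1≤d
          (¬badᵇ⇒t<rank k q t d ω valid (T-not⇒¬T (bad ω) ¬bad) t+d≤n spans) 2^d<n^1+t d-large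
      few-bad : suc m * #bad ≤ length V ^ n
      few-bad = begin
        -- From m + 1 ≤ d < 2^d: a failure fraction of 2^-d is at most 1/(m+1).
        suc m * #bad    ≤⟨ *-monoˡ-≤ #bad (≤-trans m<d (<⇒≤ (n<2^n d))) ⟩
        2 ^ d * #bad    ≡⟨ *-comm (2 ^ d) #bad ⟩
        #bad * 2 ^ d    ≤⟨ ∑-badᵇ*2^d≤ n k r t d 2≤n 1≤r 1≤d (m/n≤m n (2 * q)) t≤d n^t≤2^d d-small ⟩
        length V ^ n ∎
        where open ≤-Reasoning
      size : m * length V ^ n ≤ suc m * length L
      -- `sampleSize n q` unfolds to `length V ^ n`. Adding the bad samples to both sides takes the
      -- place of subtracting them from the total.
      size = +-cancelʳ-≤ (suc m * #bad) _ _ (begin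
        m * length V ^ n + suc m * #bad       ≤⟨ +-monoʳ-≤ (m * length V ^ n) few-bad ⟩
        m * length V ^ n + length V ^ n    ≡⟨ +-comm (m * length V ^ n) _ ⟩
        suc m * length V ^ n               ≡⟨ cong (suc m *_) (length-vecs V n) ⟨
        suc m * length Ω                   ≡⟨ cong (suc m *_) (length-filter-not bad Ω) ⟨
        suc m * (length L + #bad)             ≡⟨ *-distribˡ-+ (suc m) (length L) #bad ⟩
        suc m * length L + suc m * #bad       ∎)
        where open ≤-Reasoning
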